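{- Let $P_1$ and $P_2$ be finite semipure posets of the same length, and assume $P_2$ has a minimum element $\hat 0_2$. Let $\lambda_1:\mathrm{Cov}(\hat P_1)\to L_1$ be an EL-labeling of $\hat P_1$, whose adjoined minimum and maximum are denoted $\hat 0_1,\hat 1_1$, and let $\lambda_2:\mathrm{Cov}(P_2)\to L_2$ be a semi-EL-labeling of $P_2$. Let $L_2\uplus\{\hat 0_{L_2}\}$ be the poset $L_2$ with a new minimum element $\hat 0_{L_2}$ adjoined, and give $L_1\times(L_2\uplus\{\hat 0_{L_2}\})$ the componentwise (product) order. Denote the minimum of $\widehat{P_1*P_2}$ by $(\hat 0_1,\hat 0_2)$ and its maximum by $\hat 1$. Define $\lambda:\mathrm{Cov}(\widehat{P_1*P_2})\to L_1\times(L_2\uplus\{\hat 0_{L_2}\})$ as follows: for a cover $(x,k)\lessdot(y,l)$ with $(y,l)\neq\hat 1$ (where $(x,k)$ may be the minimum $(\hat 0_1,\hat 0_2)$), $$\lambda((x,k),(y,l))=\begin{cases}(\lambda_1(x,y),\lambda_2(k,l)) & \text{if } k<_{P_2} l,\\ (\lambda_1(x,y),\hat 0_{L_2}) & \text{if } k=l,\end{cases}$$ and for a cover $(x,k)\lessdot\hat 1$, $\lambda((x,k),\hat 1)=(\lambda_1(x,\hat 1_1),\hat 0_{L_2})$. Then $\lambda$ is an EL-labeling of $\widehat{P_1*P_2}$.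
   Context: All posets are finite. A poset $P$ is semipure if for every $x\in P$ all maximal chains of $P_{\le x}=\{y\in P:y\le x\}$ have the same length; this length is the rank $r_P(x)$. For semipure $P,Q$, the Rees product $P*Q$ is the set $\{(p,q)\in P\times Q: r_P(p)\ge r_Q(q)\}$ ordered by $(p_1,q_1)\le(p_2,q_2)$ iff $p_1\le_P p_2$, $q_1\le_Q q_2$ and $r_P(p_2)-r_P(p_1)\ge r_Q(q_2)-r_Q(q_1)$; equivalently $(p_2,q_2)$ covers $(p_1,q_1)$ iff $p_2$ covers $p_1$ in $P$ and either $q_2=q_1$ or $q_2$ covers $q_1$ in $Q$. For any poset $P$, $\hat P$ denotes $P$ with a new minimum $\hat 0$ and a new maximum $\hat 1$ adjoined (even if $P$ already has such elements). $\mathrm{Cov}(P)$ is the set of pairs $(x,y)$ with $y$ covering $x$. For a poset $L$, sequences over $L$ are compared lexicographically: $(a_1,\dots,a_m)\prec(b_1,\dots,b_m)$ if at the first index $i$ with $a_i\ne b_i$ we have $a_i<b_i$. An edge labeling of a bounded poset $P$ is a map $\lambda:\mathrm{Cov}(P)\to L$; the label sequence of a saturated chain $x_1<\dots<x_m$ is $(\lambda(x_1,x_2),\dots,\lambda(x_{m-1},x_m))$, and the chain is weakly increasing if $\lambda(x_i,x_{i+1})\le\lambda(x_{i+1},x_{i+2})$ for all $i$. $\lambda$ is an EL-labeling if for every $x<y$ in $P$ there is a unique weakly increasing maximal chain $C$ of $[x,y]$ and its label sequence lexicographically precedes ($\prec$) the label sequence of every other maximal chain of $[x,y]$. If $P$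 has a minimum $\hat 0$, an edge labeling of $P$ is a semi-EL-labeling if its restriction to $[\hat 0,m]$ is an EL-labeling for every maximal element $m$ of $P$. -}

module Defs where

open import Level using (Level; _⊔_) renaming (suc to lsuc)
open import Data.Empty using (⊥; ⊥-elim-irr)
open import Data.Product using (Σ; ∃; ∃!; _×_; _,_; proj₁; proj₂)
open import Data.Sum using (_⊎_; inj₁; inj₂)
open import Data.Nat using (ℕ; suc; _+_; z≤n; s≤s)
  renaming (_≤_ to _≤ℕ_; _<_ to _<ℕ_; _≤?_ to _≤ℕ?_)
import Data.Nat.Properties as ℕ
open import Data.Nat.Tactic.RingSolver using (solve-∀)
open import Data.Fin using (Fin)
open import Data.Fin.Induction using (spo-wellFounded; spo-noetherian)
open import Data.List using
  (List; []; _∷_; [_]; _++_; _∷ʳ_; length; map; mapMaybe; filter; cartesianProduct; lookup)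
import Data.List.Properties as List
open import Data.List.Membership.Propositional using (_∈_; lose)
open import Data.List.Membership.Propositional.Properties
  using (∈-map⁺; ∈-cartesianProduct⁺; ∈-filter⁺; ∈-++⁺ˡ; ∈-++⁺ʳ)
open import Data.List.Relation.Binary.Lex.Strict using (Lex-<)
open import Data.List.Relation.Binary.Subset.Propositional using (_⊆_)
open import Data.List.Relation.Unary.All using (All; []; _∷_)
import Data.List.Relation.Unary.All as All
import Data.List.Relation.Unary.All.Properties as AllP
open import Data.List.Relation.Unary.AllPairs using (AllPairs; []; _∷_)
import Data.List.Relation.Unary.AllPairs.Properties as AllPairsP
open import Data.List.Relation.Unary.Any using (here; there; any?; index; satisfied)
import Data.List.Relation.Unary.Any.Properties as AnyP
import Data.List.Relation.Unary.Enumerates.Setoid as Enumerates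
open import Data.List.Relation.Unary.Linked using (Linked; []; [-]; _∷_)
import Data.List.Relation.Unary.Linked as Linked
open import Data.List.Relation.Unary.Linked.Properties
  using (Linked⇒All; Linked⇒AllPairs; AllPairs⇒Linked)
  renaming (filter⁺ to Linked-filter⁺)
open import Data.Maybe using (Maybe; just; nothing)
import Data.Maybe.Relation.Unary.Any as MAny
open import Data.Product.Relation.Binary.Pointwise.NonDependent using (×-poset)
open import Function using (_on_; flip)
open import Induction.WellFounded using (WellFounded; Acc; acc; module Subrelation)
open import Relation.Binary using (Rel; Poset; IsDecPartialOrder; IsStrictPartialOrder; Minimum)
import Relation.Binary.Construct.Add.Extrema.NonStrict as AddExtrema
import Relation.Binary.Construct.Add.Infimum.NonStrict as AddInfimum
import Relation.Binary.Construct.NonStrictToStrict as ToStrict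
import Relation.Binary.Construct.On as On
open import Relation.Binary.PropositionalEquality
  using (_≡_; _≢_; refl; sym; trans; cong; subst; subst₂; setoid; isEquivalence)
open import Relation.Nullary using (¬_; Dec; yes; no; contradiction)
open import Relation.Nullary.Decidable using (_×-dec_; ¬?; map′)
open import Relation.Nullary.Construct.Add.Extrema using (_±; ⊥±; ⊤±) renaming ([_] to [_]±)
open import Relation.Nullary.Construct.Add.Infimum using (_₋; ⊥₋) renaming ([_] to [_]₋)
open import Relation.Unary using (Pred; U)

private
  variable
    a ℓ a₁ ℓ₁ a₂ ℓ₂ c e o c′ e′ o′ s : Level

record FinPoset (a ℓ : Level) : Set (lsuc (a ⊔ ℓ)) where
  infix 4 _≤_ _⋖_
  field
    Carrier           : Set a
    _≤_               : Rel Carrier ℓ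
    isDecPartialOrder : IsDecPartialOrder _≡_ _≤_
    elements          : List Carrier
    complete          : Enumerates.IsEnumeration (setoid Carrier) elements

  open IsDecPartialOrder isDecPartialOrder public
    using (_≟_; _≤?_; isPartialOrder; antisym)
    renaming (refl to ≤-refl; trans to ≤-trans; reflexive to ≤-reflexive)

  open ToStrict _≡_ _≤_ public using (_<_)

  _⋖_ : Rel Carrier (a ⊔ ℓ)
  x ⋖ y = x < y × (∀ z → ¬ (x < z × z < y))

module _ (P : FinPoset a ℓ) where
  open FinPoset P

  Maximal : Carrier → Set (a ⊔ ℓ)
  Maximal m = ∀ z → ¬ (m < z)

  -- A chain is represented by the list of its elements in increasing order.
  Chain : Pred Carrier s → List Carrier → Set (a ⊔ ℓ ⊔ s)
  Chain S xs = Linked _<_ xs × All S xs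

  MaximalChain : Pred Carrier s → List Carrier → Set (a ⊔ ℓ ⊔ s)
  MaximalChain S xs = Chain S xs × (∀ ys → Chain S ys → xs ⊆ ys → ys ⊆ xs)

  Down : Carrier → Pred Carrier ℓ
  Down x y = y ≤ x

  Interval : Carrier → Carrier → Pred Carrier ℓ
  Interval x y z = x ≤ z × z ≤ y

  -- The length of a chain is one less than its number of elements.
  HasLength : ℕ → Set (a ⊔ ℓ)
  HasLength n = (∃ λ xs → Chain U xs × length xs ≡ suc n)
              × (∀ xs → Chain U xs → length xs ≤ℕ suc n)

  -- Every P≤x has a maximal chain (maximalChain-exists below), so rank is
  -- determined by rank-length, and such a function exists exactly when all
  -- maximal chains of each P≤x have the same length.
  record Semipure : Set (a ⊔ ℓ) where
    field
      rank        : Carrier → ℕ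
      rank-length : ∀ x xs → MaximalChain (Down x) xs → length xs ≡ suc (rank x)

SameLength : FinPoset a₁ ℓ₁ → FinPoset a₂ ℓ₂ → Set (a₁ ⊔ ℓ₁ ⊔ a₂ ⊔ ℓ₂)
SameLength P Q = ∃ λ n → HasLength P n × HasLength Q n

module FinPosetProperties (P : FinPoset a ℓ) where
  open FinPoset P

  infix 4 _<?_

  _<?_ : ∀ x y → Dec (x < y)
  x <? y = (x ≤? y) ×-dec ¬? (x ≟ y)

  <-isStrictPartialOrder : IsStrictPartialOrder _≡_ _<_
  <-isStrictPartialOrder = ToStrict.<-isStrictPartialOrder _≡_ _≤_ isPartialOrder

  <-trans : ∀ {x y z} → x < y → y < z → x < z
  <-trans = IsStrictPartialOrder.trans <-isStrictPartialOrder

  <-irrefl : ∀ {x} → ¬ (x < x)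
  <-irrefl (_ , x≢x) = x≢x refl

  <-≤-trans : ∀ {x y z} → x < y → y ≤ z → x < z
  <-≤-trans (x≤y , x≢y) y≤z =
    ≤-trans x≤y y≤z , λ { refl → x≢y (antisym x≤y y≤z) }

  ≤-<-trans : ∀ {x y z} → x ≤ y → y < z → x < z
  ≤-<-trans x≤y (y≤z , y≢z) =
    ≤-trans x≤y y≤z , λ { refl → y≢z (antisym y≤z x≤y) }

  private
    position : Carrier → Fin (length elements)
    position x = index (complete x)

    lookup-position : ∀ x → lookup elements (position x) ≡ x
    lookup-position x = sym (AnyP.lookup-index (complete x))

    on-lookup : IsStrictPartialOrder (_≡_ on lookup elements) (_<_ on lookup elements)
    on-lookup = On.isStrictPartialOrder (lookup elements) <-isStrictPartialOrder

  <-wellFounded : WellFounded _<_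
  <-wellFounded = Subrelation.wellFounded
    (λ {x} {y} → subst₂ _<_ (sym (lookup-position x)) (sym (lookup-position y)))
    (On.wellFounded position (spo-wellFounded on-lookup))

  >-wellFounded : WellFounded (flip _<_)
  >-wellFounded = Subrelation.wellFounded
    (λ {x} {y} → subst₂ _<_ (sym (lookup-position y)) (sym (lookup-position x)))
    (On.wellFounded position (spo-noetherian on-lookup))

  between? : ∀ x y → Dec (∃ λ z → x < z × z < y)
  between? x y = map′ satisfied (λ { (z , p) → lose (complete z) p })
    (any? (λ z → (x <? z) ×-dec (z <? y)) elements)

  below? : ∀ y → Dec (∃ λ z → z < y)
  below? y = map′ satisfied (λ { (z , p) → lose (complete z) p })
    (any? (_<? y) elements)

  lowerCover : ∀ {x y} → x < y → ∃ λ z → x ≤ z × z ⋖ y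
  lowerCover {x} {y} x<y = go (>-wellFounded x) x<y
    where
    go : ∀ {x} → Acc (flip _<_) x → x < y → ∃ λ z → x ≤ z × z ⋖ y
    go {x} (acc rec) x<y with between? x y
    ... | no gap = x , ≤-refl , x<y , λ z p → gap (z , p)
    ... | yes (w , x<w , w<y) with go (rec x<w) w<y
    ...   | z , w≤z , z⋖y = z , ≤-trans (proj₁ x<w) w≤z , z⋖y

  upperCover : ∀ {x y} → x < y → ∃ λ z → x ⋖ z × z ≤ y
  upperCover {x} {y} x<y = go (<-wellFounded y) x<y
    where
    go : ∀ {y} → Acc _<_ y → x < y → ∃ λ z → x ⋖ z × z ≤ y
    go {y} (acc rec) x<y with between? x y
    ... | no gap = y , (x<y , λ z p → gap (z , p)) , ≤-refl
    ... | yes (w , x<w , w<y) with go (rec w<y) x<w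
    ...   | z , x⋖z , z≤w = z , x⋖z , ≤-trans z≤w (proj₁ w<y)

  minimalBelow : ∀ x → ∃ λ m → m ≤ x × (∀ z → ¬ (z < m))
  minimalBelow x = go (<-wellFounded x)
    where
    go : ∀ {x} → Acc _<_ x → ∃ λ m → m ≤ x × (∀ z → ¬ (z < m))
    go {x} (acc rec) with below? x
    ... | no none = x , ≤-refl , λ z z<x → none (z , z<x)
    ... | yes (y , y<x) with go (rec y<x)
    ...   | m , m≤y , min = m , ≤-trans m≤y (proj₁ y<x) , min

  Comparable : Carrier → Pred Carrier (a ⊔ ℓ)
  Comparable z w = w < z ⊎ z < w

  chain-comparable : ∀ {xs x y} → Linked _<_ xs → x ∈ xs → y ∈ xs →
                     x ≡ y ⊎ Comparable y x
  chain-comparable {xs} xs↗ = go (Linked⇒AllPairs <-trans xs↗)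
    where
    go : ∀ {xs x y} → AllPairs _<_ xs → x ∈ xs → y ∈ xs → x ≡ y ⊎ Comparable y x
    go (_   ∷ _)  (here refl) (here refl) = inj₁ refl
    go (x<s ∷ _)  (here refl) (there y∈)  = inj₂ (inj₁ (All.lookup x<s y∈))
    go (y<s ∷ _)  (there x∈)  (here refl) = inj₂ (inj₂ (All.lookup y<s x∈))
    go (_   ∷ ps) (there x∈)  (there y∈)  = go ps x∈ y∈

  -- No element can be inserted into a maximal chain.
  maximal-closed : ∀ {S : Pred Carrier s} {xs z} → MaximalChain P S xs → S z →
                   ¬ All (Comparable z) xs
  maximal-closed {S = S} {xs} {z} ((xs↗ , Sxs) , max) Sz cmp =
    z∉xs (max ys (ys↗ , Sys) xs⊆ys z∈ys)
    where
    lo hi ys : List Carrier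
    lo = filter (_<? z) xs
    hi = filter (z <?_) xs
    ys = lo ++ z ∷ hi

    lo<z : All (_< z) lo
    lo<z = AllP.all-filter (_<? z) xs

    z<hi : All (z <_) hi
    z<hi = AllP.all-filter (z <?_) xs

    pairs : AllPairs _<_ xs
    pairs = Linked⇒AllPairs <-trans xs↗

    ys↗ : Linked _<_ ys
    ys↗ = AllPairs⇒Linked (AllPairsP.++⁺
      (AllPairsP.filter⁺ (_<? z) pairs)
      (z<hi ∷ AllPairsP.filter⁺ (z <?_) pairs)
      (All.map (λ w<z → w<z ∷ All.map (<-trans w<z) z<hi) lo<z))

    Sys : All S ys
    Sys = AllP.++⁺ (AllP.filter⁺ (_<? z) Sxs) (Sz ∷ AllP.filter⁺ (z <?_) Sxs)

    xs⊆ys : xs ⊆ ys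
    xs⊆ys w∈ with All.lookup cmp w∈
    ... | inj₁ w<z = ∈-++⁺ˡ (∈-filter⁺ (_<? z) w∈ w<z)
    ... | inj₂ z<w = ∈-++⁺ʳ lo (there (∈-filter⁺ (z <?_) w∈ z<w))

    z∈ys : z ∈ ys
    z∈ys = ∈-++⁺ʳ lo (here refl)

    z∉xs : ¬ (z ∈ xs)
    z∉xs z∈ with All.lookup cmp z∈
    ... | inj₁ z<z = <-irrefl z<z
    ... | inj₂ z<z = <-irrefl z<z

  maximal⇒saturated : ∀ {x y xs} → MaximalChain P (Interval P x y) xs → Linked _⋖_ xs
  maximal⇒saturated {x} {y} m = start (proj₁ (proj₁ m)) (proj₂ (proj₁ m)) (maximal-closed m)
    where
    I : Pred Carrier _
    I = Interval P x y

    go : ∀ {w ws} → Linked _<_ (w ∷ ws) → All I (w ∷ ws) →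
         (∀ {z} → I z → w < z → ¬ All (Comparable z) (w ∷ ws)) → Linked _⋖_ (w ∷ ws)
    go [-] _ _ = [-]
    go {w} {v ∷ _} (w<v ∷ vs↗) (Iw ∷ Ivs) closed =
      (w<v , λ z p → closed
        (≤-trans (proj₁ Iw) (proj₁ (proj₁ p)) , ≤-trans (proj₁ (proj₂ p)) (proj₂ (All.head Ivs)))
        (proj₁ p)
        (inj₁ (proj₁ p) ∷ All.map inj₂ (Linked⇒All <-trans (proj₂ p) vs↗)))
      ∷ go vs↗ Ivs (λ Iz v<z cmp → closed Iz (<-trans w<v v<z) (inj₁ (<-trans w<v v<z) ∷ cmp))

    start : ∀ {ws} → Linked _<_ ws → All I ws →
            (∀ {z} → I z → ¬ All (Comparable z) ws) → Linked _⋖_ ws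
    start {[]}    _   _   _      = []
    start {_ ∷ _} ws↗ Iws closed = go ws↗ Iws (λ Iz _ → closed Iz)

  maximalChain-minimal : ∀ {x} → (∀ z → ¬ (z < x)) → MaximalChain P (Down P x) [ x ]
  maximalChain-minimal {x} min = ([-] , ≤-refl ∷ []) , λ ys (_ , ys≤x) _ {w} w∈ → only w (All.lookup ys≤x w∈)
    where
    only : ∀ w → w ≤ x → w ∈ [ x ]
    only w w≤x with w ≟ x
    ... | yes refl = here refl
    ... | no w≢x = contradiction (w≤x , w≢x) (min w)

  maximalChain-top : ∀ {x xs} → MaximalChain P (Down P x) xs → x ∈ xs
  maximalChain-top {x} {xs} m with any? (x ≟_) xs
  ... | yes x∈ = x∈
  ... | no x∉ = contradiction
    (All.tabulate λ {w} w∈ →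
      inj₁ (All.lookup (proj₂ (proj₁ m)) w∈ , λ { refl → x∉ w∈ }))
    (maximal-closed m ≤-refl)

  maximalChain-∷ʳ : ∀ {x y xs} → MaximalChain P (Down P x) xs → x ⋖ y →
                    MaximalChain P (Down P y) (xs ∷ʳ y)
  maximalChain-∷ʳ {x} {y} {xs} m@((xs↗ , xs≤x) , max) (x<y , gap) =
    (AllPairs⇒Linked (AllPairsP.++⁺ (Linked⇒AllPairs <-trans xs↗) ([] ∷ [])
       (All.map (λ w≤x → ≤-<-trans w≤x x<y ∷ []) xs≤x))
    , AllP.++⁺ (All.map (λ w≤x → ≤-trans w≤x (proj₁ x<y)) xs≤x) (≤-refl ∷ []))
    , max′
    where
    max′ : ∀ ys → Chain P (Down P y) ys → (xs ∷ʳ y) ⊆ ys → ys ⊆ (xs ∷ʳ y)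
    max′ ys (ys↗ , ys≤y) xsy⊆ys {w} w∈ = by-cases (w ≟ y)
      where
      zs : List Carrier
      zs = filter (_≤? x) ys

      low : w ≤ x → w ∈ xs ∷ʳ y
      low w≤x = ∈-++⁺ˡ (max zs
        (Linked-filter⁺ (_≤? x) <-trans ys↗ , AllP.all-filter (_≤? x) ys)
        (λ v∈ → ∈-filter⁺ (_≤? x) (xsy⊆ys (∈-++⁺ˡ v∈)) (All.lookup xs≤x v∈))
        (∈-filter⁺ (_≤? x) w∈ w≤x))

      by-cases : Dec (w ≡ y) → w ∈ xs ∷ʳ y
      by-cases (yes refl) = ∈-++⁺ʳ xs (here refl)
      by-cases (no w≢y)
        with chain-comparable ys↗ w∈ (xsy⊆ys (∈-++⁺ˡ (maximalChain-top m)))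
      ... | inj₁ refl = low ≤-refl
      ... | inj₂ (inj₁ w<x) = low (proj₁ w<x)
      ... | inj₂ (inj₂ x<w) = contradiction (x<w , All.lookup ys≤y w∈ , w≢y) (gap w)

  maximalChain-exists : ∀ x → ∃ (MaximalChain P (Down P x))
  maximalChain-exists x = go (<-wellFounded x)
    where
    go : ∀ {x} → Acc _<_ x → ∃ (MaximalChain P (Down P x))
    go {x} (acc rec) with below? x
    ... | no none = [ x ] , maximalChain-minimal (λ z z<x → none (z , z<x))
    ... | yes (y , y<x) with lowerCover y<x
    ...   | z , _ , z⋖x with go (rec (proj₁ z⋖x))
    ...     | xs , m = xs ∷ʳ x , maximalChain-∷ʳ m z⋖x

module SemipureProperties (P : FinPoset a ℓ) (sP : Semipure P) where
  open FinPoset P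
  open FinPosetProperties P
  open Semipure sP

  rank-minimal : ∀ {x} → (∀ z → ¬ (z < x)) → rank x ≡ 0
  rank-minimal min = sym (ℕ.suc-injective (rank-length _ _ (maximalChain-minimal min)))

  rank-⋖ : ∀ {x y} → x ⋖ y → rank y ≡ suc (rank x)
  rank-⋖ {x} {y} x⋖y with maximalChain-exists x
  ... | xs , m = ℕ.suc-injective (trans
    (sym (rank-length y (xs ∷ʳ y) (maximalChain-∷ʳ m x⋖y)))
    (trans (List.length-++ xs)
      (trans (ℕ.+-comm (length xs) 1) (cong suc (rank-length x xs m)))))

  rank-< : ∀ {x y} → x < y → rank x <ℕ rank y
  rank-< {x} {y} = go (<-wellFounded y)
    where
    go : ∀ {y} → Acc _<_ y → x < y → rank x <ℕ rank y
    go (acc rec) x<y with lowerCover x<y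
    ... | z , x≤z , z⋖y with x ≟ z
    ...   | yes refl = ℕ.≤-reflexive (sym (rank-⋖ z⋖y))
    ...   | no x≢z = ℕ.<-trans (go (rec (proj₁ z⋖y)) (x≤z , x≢z))
                               (ℕ.≤-reflexive (sym (rank-⋖ z⋖y)))

  rank-≤ : ∀ {x y} → x ≤ y → rank x ≤ℕ rank y
  rank-≤ {x} {y} x≤y with x ≟ y
  ... | yes refl = ℕ.≤-refl
  ... | no x≢y = ℕ.<⇒≤ (rank-< (x≤y , x≢y))

hat : FinPoset a ℓ → FinPoset a (a ⊔ ℓ)
hat P = record
  { Carrier           = Carrier ±
  ; _≤_               = AddExtrema._≤±_ _≤_
  ; isDecPartialOrder = AddExtrema.≤±-isDecPartialOrder-≡ _≤_ isDecPartialOrder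
  ; elements          = ⊥± ∷ ⊤± ∷ map [_]± elements
  ; complete          = λ where
      ⊥±     → here refl
      ⊤±     → there (here refl)
      [ x ]± → there (there (∈-map⁺ [_]± (complete x)))
  }
  where open FinPoset P

module HatProperties (P : FinPoset a ℓ) where
  private
    module P = FinPoset P
    module P^ = FinPoset (hat P)

  [<]-injective : ∀ {x y} → [ x ]± P^.< [ y ]± → x P.< y
  [<]-injective (x≤y , x≢y) = AddExtrema.[≤]-injective P._≤_ x≤y , λ { refl → x≢y refl }

  [<]⁺ : ∀ {x y} → x P.< y → [ x ]± P^.< [ y ]±
  [<]⁺ (x≤y , x≢y) = AddExtrema.[_] x≤y , λ { refl → x≢y refl }

  ⊥<[] : ∀ {x} → ⊥± P^.< [ x ]±
  ⊥<[] = AddExtrema.⊥±≤_ P._≤_ _ , λ ()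

  []<⊤ : ∀ {x} → [ x ]± P^.< ⊤±
  []<⊤ = AddExtrema._≤⊤± P._≤_ _ , λ ()

  ⊥<⊤ : ⊥± P^.< ⊤±
  ⊥<⊤ = AddExtrema._≤⊤± P._≤_ _ , λ ()

  ≮⊥ : ∀ {u} → ¬ (u P^.< ⊥±)
  ≮⊥ {u} (u≤⊥ , u≢⊥) = u≢⊥ (P^.antisym u≤⊥ (AddExtrema.⊥±≤_ P._≤_ u))

  ⊤≮ : ∀ {u} → ¬ (⊤± P^.< u)
  ⊤≮ {u} (⊤≤u , ⊤≢u) = ⊤≢u (P^.antisym ⊤≤u (AddExtrema._≤⊤± P._≤_ u))

  ⊥⋖[]⁺ : ∀ {x} → (∀ z → ¬ (z P.< x)) → ⊥± P^.⋖ [ x ]±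
  ⊥⋖[]⁺ min = ⊥<[] , λ where
    ⊥±     (p , _) → ≮⊥ p
    [ z ]± (_ , q) → min z ([<]-injective q)
    ⊤±     (_ , q) → ⊤≮ q

  []⋖⊤⁺ : ∀ {x} → Maximal P x → [ x ]± P^.⋖ ⊤±
  []⋖⊤⁺ max = []<⊤ , λ where
    ⊥±     (p , _) → ≮⊥ p
    [ z ]± (p , _) → max z ([<]-injective p)
    ⊤±     (_ , q) → ⊤≮ q

  []⋖[]⁺ : ∀ {x y} → x P.⋖ y → [ x ]± P^.⋖ [ y ]±
  []⋖[]⁺ (x<y , gap) = [<]⁺ x<y , λ where
    ⊥±     (p , _) → ≮⊥ p
    [ z ]± (p , q) → gap z ([<]-injective p , [<]-injective q)
    ⊤±     (_ , q) → ⊤≮ q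

  []⋖[]⁻ : ∀ {x y} → [ x ]± P^.⋖ [ y ]± → x P.⋖ y
  []⋖[]⁻ (x<y , gap) = [<]-injective x<y , λ z (p , q) → gap [ z ]± ([<]⁺ p , [<]⁺ q)

  ⊥⋖⊤⁺ : ¬ P.Carrier → ⊥± P^.⋖ ⊤±
  ⊥⋖⊤⁺ empty = ⊥<⊤ , λ where
    ⊥±     (p , _) → ≮⊥ p
    [ z ]± _       → empty z
    ⊤±     (_ , q) → ⊤≮ q

module Rees (P : FinPoset a₁ ℓ₁) (Q : FinPoset a₂ ℓ₂)
            (sP : Semipure P) (sQ : Semipure Q) where

  private
    module P = FinPoset P
    module Q = FinPoset Q
    module PP = FinPosetProperties P
    module QP = FinPosetProperties Q
    module PS = SemipureProperties P sP
    module QS = SemipureProperties Q sQ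

  open Semipure sP using () renaming (rank to rP)
  open Semipure sQ using () renaming (rank to rQ)

  record Element : Set (a₁ ⊔ a₂) where
    constructor element
    field
      fst    : P.Carrier
      snd    : Q.Carrier
      rank≥  : rQ snd ≤ℕ rP fst
  open Element public

  infix 4 _≤_

  -- The last component is rQ (snd v) − rQ (snd u) ≤ rP (fst v) − rP (fst u),
  -- rearranged so that no natural-number subtraction is needed.
  _≤_ : Rel Element (ℓ₁ ⊔ ℓ₂)
  u ≤ v = fst u P.≤ fst v × snd u Q.≤ snd v
        × rQ (snd v) + rP (fst u) ≤ℕ rP (fst v) + rQ (snd u)

  element-≡ : ∀ {u v} → fst u ≡ fst v → snd u ≡ snd v → u ≡ v
  element-≡ {element _ _ h} {element _ _ k} refl refl = cong (element _ _) (ℕ.≤-irrelevant h k)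

  private
    ≤-trans : ∀ {u v w} → u ≤ v → v ≤ w → u ≤ w
    ≤-trans {u} {v} {w} (p , q , r) (p′ , q′ , r′) =
      P.≤-trans p p′ , Q.≤-trans q q′ ,
      ℕ.+-cancelʳ-≤ (rP (fst v) + rQ (snd v)) _ _
        (subst₂ _≤ℕ_
          (shuffle₁ (rQ (snd v)) (rP (fst u)) (rQ (snd w)) (rP (fst v)))
          (shuffle₂ (rP (fst v)) (rQ (snd u)) (rP (fst w)) (rQ (snd v)))
          (ℕ.+-mono-≤ r r′))
      where
      shuffle₁ : ∀ qv pu qw pv → (qv + pu) + (qw + pv) ≡ (qw + pu) + (pv + qv)
      shuffle₁ = solve-∀
      shuffle₂ : ∀ pv qu pw qv → (pv + qu) + (pw + qv) ≡ (pw + qu) + (pv + qv)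
      shuffle₂ = solve-∀

    ≤-reflexive : ∀ {u v} → u ≡ v → u ≤ v
    ≤-reflexive {u} refl = P.≤-refl , Q.≤-refl , ℕ.≤-reflexive (ℕ.+-comm (rQ (snd u)) (rP (fst u)))

    toElement : P.Carrier × Q.Carrier → Maybe Element
    toElement (p , q) with rQ q ≤ℕ? rP p
    ... | yes h = just (element p q h)
    ... | no  _ = nothing

    toElement-complete : ∀ u → MAny.Any (u ≡_) (toElement (fst u , snd u))
    toElement-complete u with rQ (snd u) ≤ℕ? rP (fst u)
    ... | yes _ = MAny.just (element-≡ refl refl)
    ... | no h  = contradiction (rank≥ u) h

  reesProduct : FinPoset (a₁ ⊔ a₂) (ℓ₁ ⊔ ℓ₂)
  reesProduct = record
    { Carrier           = Element
    ; _≤_               = _≤_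
    ; isDecPartialOrder = record
      { isPartialOrder = record
        { isPreorder = record
          { isEquivalence = isEquivalence
          ; reflexive     = ≤-reflexive
          ; trans         = λ {u} {v} {w} → ≤-trans {u} {v} {w}
          }
        ; antisym = λ (p , q , _) (p′ , q′ , _) → element-≡ (P.antisym p p′) (Q.antisym q q′)
        }
      ; _≟_  = λ u v → map′ (λ (p , q) → element-≡ p q) (λ { refl → refl , refl })
                 ((fst u P.≟ fst v) ×-dec (snd u Q.≟ snd v))
      ; _≤?_ = λ u v → (fst u P.≤? fst v) ×-dec ((snd u Q.≤? snd v)
                 ×-dec (rQ (snd v) + rP (fst u) ≤ℕ? rP (fst v) + rQ (snd u)))
      }
    ; elements = mapMaybe toElement (cartesianProduct P.elements Q.elements)
    ; complete = λ u → AnyP.mapMaybe⁺ toElement (cartesianProduct P.elements Q.elements)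
        (lose (∈-map⁺ toElement (∈-cartesianProduct⁺ (P.complete (fst u)) (Q.complete (snd u))))
              (toElement-complete u))
    }

  private
    module R = FinPoset reesProduct
    module R^ = FinPoset (hat reesProduct)
    module P^ = FinPoset (hat P)

    -- An upper cover of fst u below fst v, together with an upper cover of
    -- snd u below snd v, gives an element of the product between u and v.
    diagonal : ∀ {u v p q} → rP p ≡ suc (rP (fst u)) → rQ q ≡ suc (rQ (snd u)) →
               u ≤ v → fst u P.≤ p → p P.≤ fst v → snd u Q.≤ q → q Q.≤ snd v →
               ∃ λ w → fst w ≡ p × u ≤ w × w ≤ v
    diagonal {u} {v} {p} {q} ep eq (_ , _ , r) u≤p p≤v u≤q q≤v =
      element p q (subst₂ _≤ℕ_ (sym eq) (sym ep) (s≤s (rank≥ u))) , refl ,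
      (u≤p , u≤q , ℕ.≤-reflexive (trans (cong (_+ rP (fst u)) eq)
        (trans (swap (rQ (snd u)) (rP (fst u))) (cong (_+ rQ (snd u)) (sym ep))))) ,
      (p≤v , q≤v , subst₂ (λ m n → rQ (snd v) + m ≤ℕ rP (fst v) + n) (sym ep) (sym eq)
        (subst₂ _≤ℕ_ (sym (ℕ.+-suc _ _)) (sym (ℕ.+-suc _ _)) (s≤s r)))
      where
      swap : ∀ m n → suc m + n ≡ suc n + m
      swap m n = cong suc (ℕ.+-comm m n)

  fst-≢ : ∀ {u v} → fst u P.< fst v → u ≢ v
  fst-≢ u<v refl = PP.<-irrefl u<v

  <-fst : ∀ {u v} → u R.< v → fst u P.< fst v
  <-fst {u} {v} ((p , q , r) , u≢v) = p , distinct
    where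
    distinct : fst u ≢ fst v
    distinct e with snd u Q.≟ snd v
    ... | yes e′ = u≢v (element-≡ e e′)
    ... | no ne = ℕ.<⇒≱ (QS.rank-< (q , ne))
      (ℕ.+-cancelˡ-≤ (rP (fst u)) _ _
        (subst₂ _≤ℕ_ (ℕ.+-comm _ (rP (fst u))) (cong (λ x → rP x + rQ (snd u)) (sym e)) r))

  ⋖-fst : ∀ {u v} → u R.⋖ v → fst u P.⋖ fst v
  ⋖-fst {u} {v} (u<v@((p , q , r) , u≢v) , gap) = <-fst u<v , λ z (u<z , z<v) → no-gap u<z z<v
    where
    no-gap : ∀ {z} → fst u P.< z → z P.< fst v → ⊥
    no-gap {z} u<z z<v with snd u Q.≟ snd v
    ... | yes e =
      gap (element z (snd u) (ℕ.≤-trans (rank≥ u) (PS.rank-≤ (proj₁ u<z))))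
        ( ((proj₁ u<z , Q.≤-refl , stay (PS.rank-≤ (proj₁ u<z))) , fst-≢ u<z)
        , ((proj₁ z<v , Q.≤-reflexive e ,
            subst (λ k → rQ k + rP z ≤ℕ rP (fst v) + rQ (snd u)) e (stay (PS.rank-≤ (proj₁ z<v))))
          , fst-≢ z<v) )
      where
      stay : ∀ {m n k} → m ≤ℕ n → k + m ≤ℕ n + k
      stay {m} {n} {k} m≤n = subst (k + m ≤ℕ_) (ℕ.+-comm k n) (ℕ.+-monoʳ-≤ k m≤n)
    ... | no ne with PP.upperCover u<z | QP.upperCover (q , ne)
    ...   | p′ , u⋖p′ , p′≤z | q′ , u⋖q′ , q′≤v
        with diagonal {u} {v} (PS.rank-⋖ u⋖p′) (QS.rank-⋖ u⋖q′) (p , q , r)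
               (proj₁ (proj₁ u⋖p′)) (P.≤-trans p′≤z (proj₁ z<v)) (proj₁ (proj₁ u⋖q′)) q′≤v
    ...     | w , refl , u≤w , w≤v =
      gap w ( (u≤w , fst-≢ (proj₁ u⋖p′))
            , (w≤v , fst-≢ (PP.≤-<-trans p′≤z z<v)))

  ⋖-snd : ∀ {u v} → u R.⋖ v → snd u ≡ snd v ⊎ snd u Q.⋖ snd v
  ⋖-snd {u} {v} u⋖v@(((p , q , r) , _) , _) with snd u Q.≟ snd v
  ... | yes e = inj₁ e
  ... | no ne = inj₂ ((q , ne) , λ z (u<z , z<v) →
      ℕ.<⇒≱ (ℕ.≤-<-trans (QS.rank-< u<z) (QS.rank-< z<v)) bound)
    where
    bound : rQ (snd v) ≤ℕ suc (rQ (snd u))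
    bound = ℕ.+-cancelʳ-≤ (rP (fst u)) _ _
      (subst (rQ (snd v) + rP (fst u) ≤ℕ_)
        (trans (cong (_+ rQ (snd u)) (PS.rank-⋖ (⋖-fst u⋖v))) (cong suc (ℕ.+-comm (rP (fst u)) _)))
        r)

  module HatCovers (0̂ : Q.Carrier) (0̂-min : Minimum Q._≤_ 0̂) where

    private
      module HP = HatProperties P
      module HR = HatProperties reesProduct

      rQ-0̂ : rQ 0̂ ≡ 0
      rQ-0̂ = QS.rank-minimal λ z (z≤0̂ , z≢0̂) → z≢0̂ (Q.antisym z≤0̂ (0̂-min z))

      bottom : P.Carrier → Element
      bottom p = element p 0̂ (subst (_≤ℕ rP p) (sym rQ-0̂) z≤n)

      bottom-≤ : ∀ {p} v → (∀ z → ¬ (z P.< p)) → p P.≤ fst v → bottom p ≤ v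
      bottom-≤ {p} v p-min p≤v = p≤v , 0̂-min (snd v) ,
        subst₂ (λ m n → rQ (snd v) + m ≤ℕ rP (fst v) + n) (sym (PS.rank-minimal p-min)) (sym rQ-0̂)
          (ℕ.+-monoˡ-≤ 0 (rank≥ v))

      raise : ∀ u {p} → fst u P.< p → ∃ λ w → u R.< w
      raise u {p} u<p = element p (snd u) (ℕ.≤-trans (rank≥ u) rank-u≤p) ,
        (proj₁ u<p , Q.≤-refl ,
          subst (_≤ℕ rP p + rQ (snd u)) (ℕ.+-comm (rP (fst u)) _) (ℕ.+-monoˡ-≤ _ rank-u≤p)) ,
        fst-≢ u<p
        where
        rank-u≤p : rP (fst u) ≤ℕ rP p
        rank-u≤p = PS.rank-≤ (proj₁ u<p)

    fst^ : Element ± → P.Carrier ±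
    fst^ ⊥±     = ⊥±
    fst^ [ u ]± = [ fst u ]±
    fst^ ⊤±     = ⊤±

    ⊥⋖-minimal : ∀ {v} → ⊥± R^.⋖ [ v ]± → ∀ z → ¬ (z P.< fst v)
    ⊥⋖-minimal {v} (_ , gap) z z<v with PP.minimalBelow z
    ... | m , m≤z , m-min =
      gap [ bottom m ]±
        (HR.⊥<[] , HR.[<]⁺ ( bottom-≤ v m-min (P.≤-trans m≤z (proj₁ z<v))
                           , fst-≢ (PP.≤-<-trans m≤z z<v)))

    ⋖-fst^ : ∀ {u v} → u R^.⋖ v → fst^ u P^.⋖ fst^ v
    ⋖-fst^ {_}      {⊥±}     (u<v , _)   = contradiction u<v HR.≮⊥
    ⋖-fst^ {⊤±}     {_}      (u<v , _)   = contradiction u<v HR.⊤≮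
    ⋖-fst^ {⊥±}     {[ v ]±} u⋖v         = HP.⊥⋖[]⁺ (⊥⋖-minimal u⋖v)
    ⋖-fst^ {⊥±}     {⊤±}     (_ , gap)   = HP.⊥⋖⊤⁺ λ p →
      gap [ bottom p ]± (HR.⊥<[] , HR.[]<⊤)
    ⋖-fst^ {[ u ]±} {[ v ]±} u⋖v         = HP.[]⋖[]⁺ (⋖-fst (HR.[]⋖[]⁻ u⋖v))
    ⋖-fst^ {[ u ]±} {⊤±}     (_ , gap)   = HP.[]⋖⊤⁺ λ z u<z →
      gap [ proj₁ (raise u u<z) ]± (HR.[<]⁺ (proj₂ (raise u u<z)) , HR.[]<⊤)

    ⊥⋖-snd : ∀ {v} → ⊥± R^.⋖ [ v ]± → 0̂ ≡ snd v
    ⊥⋖-snd {v} u⋖v with 0̂ Q.≟ snd v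
    ... | yes e = e
    ... | no ne = contradiction
      (ℕ.<-≤-trans (QS.rank-< (0̂-min (snd v) , ne))
        (subst (rQ (snd v) ≤ℕ_) (PS.rank-minimal (⊥⋖-minimal u⋖v)) (rank≥ v)))
      ℕ.n≮0

    []⋖-snd : ∀ {u v} → [ u ]± R^.⋖ [ v ]± → snd u ≡ snd v ⊎ snd u Q.⋖ snd v
    []⋖-snd u⋖v = ⋖-snd (HR.[]⋖[]⁻ u⋖v)

module _ (P : FinPoset a ℓ) (L : Poset c e o) where
  open FinPoset P

  -- Irrelevance of the cover proof makes a labeling a function of the pair
  -- (x , y) alone.
  EdgeLabeling : Set (a ⊔ ℓ ⊔ c)
  EdgeLabeling = ∀ x y → .(x ⋖ y) → Poset.Carrier L

module Labeling (P : FinPoset a ℓ) (L : Poset c e o) (lab : EdgeLabeling P L) where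
  open FinPoset P
  open FinPosetProperties P using (maximal⇒saturated)
  private module L = Poset L

  labels : ∀ xs → .(Linked _⋖_ xs) → List L.Carrier
  labels []           _ = []
  labels (x ∷ [])     _ = []
  labels (x ∷ y ∷ xs) s = lab x y (Linked.head s) ∷ labels (y ∷ xs) (Linked.tail s)

  WeaklyIncreasing : ∀ xs → .(Linked _⋖_ xs) → Set (c ⊔ o)
  WeaklyIncreasing xs s = Linked L._≤_ (labels xs s)

  -- Maximal chains of an interval may differ in length.  A label sequence that
  -- is a proper initial segment of another one precedes it, as is usual for
  -- lexicographic orders.  In an EL-labeling this never happens between the
  -- increasing chain and another maximal chain of the same interval, so the
  -- choice does not affect IsEL.
  infix 4 _≺_

  _≺_ : Rel (List L.Carrier) (c ⊔ e ⊔ o)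
  _≺_ = Lex-< L._≈_ (ToStrict._<_ L._≈_ L._≤_)

  RisingChain : Carrier → Carrier → List Carrier → Set (a ⊔ ℓ ⊔ c ⊔ o)
  RisingChain x y xs = Σ (MaximalChain P (Interval P x y) xs) λ m →
    WeaklyIncreasing xs (maximal⇒saturated m)

  ELInterval : Carrier → Carrier → Set (a ⊔ ℓ ⊔ c ⊔ e ⊔ o)
  ELInterval x y = Σ (∃! _≡_ (RisingChain x y)) λ (xs , (m , _) , _) →
    ∀ ys (m′ : MaximalChain P (Interval P x y) ys) → ys ≢ xs →
    labels xs (maximal⇒saturated m) ≺ labels ys (maximal⇒saturated m′)

  IsEL : Set (a ⊔ ℓ ⊔ c ⊔ e ⊔ o)
  IsEL = ∀ x y → x < y → ELInterval x y

  -- For x < y in [0̂, m], the interval [x, y] and its covers are the same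
  -- computed in [0̂, m] as in P.
  IsSemiEL : Carrier → Set (a ⊔ ℓ ⊔ c ⊔ e ⊔ o)
  IsSemiEL 0̂ = ∀ m → Maximal P m →
    ∀ x y → Interval P 0̂ m x → Interval P 0̂ m y → x < y → ELInterval x y

open Labeling public using (IsEL; IsSemiEL)

withMinimum : Poset c e o → Poset c (c ⊔ e) (c ⊔ o)
withMinimum L = record
  { isPartialOrder = AddInfimum.≤₋-isPartialOrder (Poset._≤_ L) (Poset.isPartialOrder L) }

module _ (P₁ : FinPoset a₁ ℓ₁) (P₂ : FinPoset a₂ ℓ₂)
         (s₁ : Semipure P₁) (s₂ : Semipure P₂)
         (0̂₂ : FinPoset.Carrier P₂) (0̂₂-min : Minimum (FinPoset._≤_ P₂) 0̂₂)
         (L₁ : Poset c e o) (L₂ : Poset c′ e′ o′)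
         (λ₁ : EdgeLabeling (hat P₁) L₁) (λ₂ : EdgeLabeling P₂ L₂) where

  private
    module P₂ = FinPoset P₂
    module HR = HatProperties (Rees.reesProduct P₁ P₂ s₁ s₂)
  open Rees P₁ P₂ s₁ s₂
  open HatCovers 0̂₂ 0̂₂-min

  secondLabel : ∀ k l → .(k ≡ l ⊎ k P₂.⋖ l) → Poset.Carrier L₂ ₋
  secondLabel k l c with k P₂.≟ l
  ... | yes _  = ⊥₋
  ... | no k≢l = [ λ₂ k l (cover c) ]₋
    where
    cover : k ≡ l ⊎ k P₂.⋖ l → k P₂.⋖ l
    cover (inj₁ k≡l) = contradiction k≡l k≢l
    cover (inj₂ k⋖l) = k⋖l

  -- The minimum ⊥± of the hat of the product stands for (0̂₁ , 0̂₂).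
  reesLabeling : EdgeLabeling (hat reesProduct) (×-poset L₁ (withMinimum L₂))
  reesLabeling ⊥±     [ v ]± c =
    λ₁ ⊥± [ fst v ]± (⋖-fst^ c) , secondLabel 0̂₂ (snd v) (inj₁ (⊥⋖-snd c))
  reesLabeling [ u ]± [ v ]± c =
    λ₁ [ fst u ]± [ fst v ]± (⋖-fst^ c) , secondLabel (snd u) (snd v) ([]⋖-snd c)
  reesLabeling u      ⊤±     c = λ₁ (fst^ u) ⊤± (⋖-fst^ c) , ⊥₋
  reesLabeling u      ⊥±     c = ⊥-elim-irr (HR.≮⊥ (proj₁ c))
  reesLabeling ⊤±     [ v ]± c = ⊥-elim-irr (HR.⊤≮ (proj₁ c))

{-# OPTIONS --safe #-}
module Submission where

-- Projecting a saturated chain of the Rees product gives a saturated chain of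
-- hat P₁ in the first coordinate and a saturated chain of P₂ with repetitions
-- in the second, a repetition carrying the label ⊥₋.  The increasing chain from
-- (x , k) to (y , l) therefore follows the increasing chain of [x, y], and its
-- second coordinate first rests at k for m steps, where m is fixed by the ranks,
-- and then follows the increasing chain of [k, l].  Up to the adjoined maximum
-- the last label ⊥₋ forces the second coordinate to rest throughout.  At the
-- first difference to another chain both components of its label are smaller
-- or equal, since resting is cheapest in the second component.

open import Defs
open import Level using (Level; _⊔_)
open import Algebra.Properties.CommutativeSemigroup using (xy∙z≈xz∙y)
open import Data.List using (List; []; _∷_; _++_; map; length; replicate)
import Data.List.Properties as List
open import Data.List.Membership.Propositional using (_∈_; lose)
open import Data.List.Relation.Binary.Lex.Strict using (Lex-<; base; halt; this; next)
open import Data.List.Relation.Unary.All using (All; []; _∷_)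
import Data.List.Relation.Unary.All as All
open import Data.List.Relation.Unary.Any using (here; there; any?; satisfied)
open import Data.List.Relation.Unary.Linked using (Linked; []; [-]; _∷_)
import Data.List.Relation.Unary.Linked as Linked
open import Data.List.Relation.Unary.Linked.Properties using (Linked⇒All)
open import Data.Nat using (ℕ; zero; suc; _+_; _∸_; z≤n; s≤s) renaming (_≤_ to _≤ℕ_)
import Data.Nat.Properties as ℕ
open import Data.Product using (∃; _×_; _,_; proj₁; proj₂)
open import Data.Product.Relation.Binary.Pointwise.NonDependent using (×-poset)
open import Data.Sum using (_⊎_; inj₁; inj₂)
open import Function using (_∘_; flip)
open import Induction.WellFounded using (Acc; acc)
open import Relation.Binary using (Rel; Poset; Minimum)
open import Relation.Binary.Construct.Add.Infimum.Equality using (⊥₋≈⊥₋; [_]; [≈]-injective)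
open import Relation.Binary.Construct.Add.Infimum.NonStrict using (⊥₋≤_; [_]; [≤]-injective)
import Relation.Binary.Construct.NonStrictToStrict as ToStrict
open import Relation.Binary.PropositionalEquality
  using (_≡_; _≢_; refl; sym; trans; cong; cong₂; subst)
open import Relation.Nullary using (Dec; yes; no; contradiction)
open import Relation.Nullary.Construct.Add.Extrema using (_±; ⊥±; ⊤±) renaming ([_] to [_]±)
open import Relation.Nullary.Construct.Add.Infimum using (_₋; ⊥₋) renaming ([_] to [_]₋)
open import Relation.Nullary.Decidable using (map′)

private
  variable
    a ℓ a₁ ℓ₁ a₂ ℓ₂ c e o c₁ e₁ o₁ c₂ e₂ o₂ : Level

-- Maximal elements and the ends of maximal chains.

module _ (P : FinPoset a ℓ) where
  open FinPoset P
  open FinPosetProperties P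

  -- A semi-EL-labeling gives information only below maximal elements; this supplies one above any
  -- given interval.
  maximalAbove : ∀ x → ∃ λ m → x ≤ m × Maximal P m
  maximalAbove x = go (>-wellFounded x)
    where
    above? : ∀ x → Dec (∃ λ z → x < z)
    above? x = map′ satisfied (λ { (z , p) → lose (complete z) p }) (any? (x <?_) elements)

    go : ∀ {x} → Acc (flip _<_) x → ∃ λ m → x ≤ m × Maximal P m
    go {x} (acc rec) with above? x
    ... | no none = x , ≤-refl , λ z x<z → none (z , x<z)
    ... | yes (y , x<y) with go (rec x<y)
    ...   | m , y≤m , max = m , ≤-trans (proj₁ x<y) y≤m , max

  module _ {x y} (x≤y : x ≤ y) where

    bottom∈maximalChain : ∀ {xs} → MaximalChain P (Interval P x y) xs → x ∈ xs
    bottom∈maximalChain {xs} m with any? (x ≟_) xs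
    ... | yes x∈ = x∈
    ... | no x∉ = contradiction
      (All.tabulate λ w∈ → inj₂ (proj₁ (All.lookup (proj₂ (proj₁ m)) w∈) , λ { refl → x∉ w∈ }))
      (maximal-closed m (≤-refl , x≤y))

    top∈maximalChain : ∀ {xs} → MaximalChain P (Interval P x y) xs → y ∈ xs
    top∈maximalChain {xs} m with any? (y ≟_) xs
    ... | yes y∈ = y∈
    ... | no y∉ = contradiction
      (All.tabulate λ w∈ → inj₁ (proj₂ (All.lookup (proj₂ (proj₁ m)) w∈) , λ { refl → y∉ w∈ }))
      (maximal-closed m (x≤y , ≤-refl))

-- Maximal chains of intervals as labeled paths.

module Paths (P : FinPoset a ℓ) (L : Poset c e o) (lab : EdgeLabeling P L) where
  open FinPoset P
  open FinPosetProperties P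
  open Labeling P L lab hiding (IsEL; IsSemiEL)
  private module L = Poset L

  infixr 5 _∷_

  -- Path x y ws ls: x ∷ ws is a saturated chain from x to y with label
  -- sequence ls.
  data Path : Carrier → Carrier → List Carrier → List L.Carrier → Set (a ⊔ ℓ ⊔ c) where
    []  : ∀ {x} → Path x x [] []
    _∷_ : ∀ {x y z ws ls} (x⋖y : x ⋖ y) → Path y z ws ls →
          Path x z (y ∷ ws) (lab x y x⋖y ∷ ls)

  path-≤ : ∀ {x y ws ls} → Path x y ws ls → x ≤ y
  path-≤ []        = ≤-refl
  path-≤ (x⋖w ∷ p) = ≤-trans (proj₁ (proj₁ x⋖w)) (path-≤ p)

  path-loop : ∀ {x ws ls} → Path x x ws ls → ws ≡ [] × ls ≡ []
  path-loop []        = refl , refl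
  path-loop (x⋖w ∷ p) = contradiction (<-≤-trans (proj₁ x⋖w) (path-≤ p)) <-irrefl

  -- `lab` is irrelevant in its cover proof, so two paths through the same vertices carry the same
  -- labels even when their cover proofs differ.
  labels-unique : ∀ {x y y′ ws ws′ ls ls′} → ws ≡ ws′ →
                  Path x y ws ls → Path x y′ ws′ ls′ → ls ≡ ls′
  labels-unique refl []      []      = refl
  labels-unique refl (c ∷ p) (_ ∷ q) = cong (_ ∷_) (labels-unique refl p q)

  path⇒linked : ∀ {x y ws ls} → Path x y ws ls → Linked _⋖_ (x ∷ ws)
  path⇒linked []          = [-]
  path⇒linked (c ∷ [])    = c ∷ [-]
  path⇒linked (c ∷ d ∷ p) = c ∷ path⇒linked (d ∷ p)

  path-labels : ∀ {x y ws ls} → Path x y ws ls → .(s : Linked _⋖_ (x ∷ ws)) → labels (x ∷ ws) s ≡ ls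
  path-labels []      _ = refl
  path-labels (x⋖w ∷ p) _ = cong (lab _ _ x⋖w ∷_) (path-labels p (path⇒linked p))

  path⇒chain : ∀ {x y ws ls} → Path x y ws ls → Chain P (Interval P x y) (x ∷ ws)
  path⇒chain p = linked p , interval p
    where
    linked : ∀ {x y ws ls} → Path x y ws ls → Linked _<_ (x ∷ ws)
    linked []          = [-]
    linked (c ∷ [])    = proj₁ c ∷ [-]
    linked (c ∷ d ∷ p) = proj₁ c ∷ linked (d ∷ p)

    interval : ∀ {x y ws ls} → Path x y ws ls → All (Interval P x y) (x ∷ ws)
    interval []        = (≤-refl , ≤-refl) ∷ []
    interval (x⋖w ∷ p) = (≤-refl , path-≤ (x⋖w ∷ p)) ∷
      All.map (λ (w≤z , z≤y) → ≤-trans (proj₁ (proj₁ x⋖w)) w≤z , z≤y) (interval p)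

  -- Walking up the path, `z` cannot lie strictly inside a cover, so it stays above the current
  -- vertex until it equals one. This is what makes saturated chains maximal.
  path-complete : ∀ {x y ws ls z} → Path x y ws ls → x ≤ z → z ≤ y →
                  (∀ {w} → w ∈ x ∷ ws → z ≡ w ⊎ Comparable w z) → z ∈ x ∷ ws
  path-complete {x} {z = z} p x≤z z≤y cmp with x ≟ z
  ... | yes refl = here refl
  path-complete [] x≤z z≤y cmp | no x≢z = contradiction (antisym x≤z z≤y) x≢z
  path-complete (x⋖w ∷ p) x≤z z≤y cmp | no x≢z with cmp (there (here refl))
  ... | inj₁ refl       = there (here refl)
  ... | inj₂ (inj₁ z<w) = contradiction ((x≤z , x≢z) , z<w) (proj₂ x⋖w _)
  ... | inj₂ (inj₂ w<z) = there (path-complete p (proj₁ w<z) z≤y λ w∈ → cmp (there w∈))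

  path⇒maximalChain : ∀ {x y ws ls} → Path x y ws ls → MaximalChain P (Interval P x y) (x ∷ ws)
  path⇒maximalChain p = path⇒chain p , λ ys (ys↗ , Iys) ws⊆ys z∈ →
    path-complete p (proj₁ (All.lookup Iys z∈)) (proj₂ (All.lookup Iys z∈))
      (λ w∈ → chain-comparable ys↗ z∈ (ws⊆ys w∈))

  -- Both `x` and `y` belong to the chain, and all its members lie between them, so they must be its
  -- first and last members.
  maximalChain⇒path : ∀ {x y xs} → x ≤ y → (m : MaximalChain P (Interval P x y) xs) →
                      ∃ λ ws → xs ≡ x ∷ ws × Path x y ws (labels xs (maximal⇒saturated m))
  maximalChain⇒path {x} {y} x≤y m =
    start (bottom∈maximalChain P x≤y m) (top∈maximalChain P x≤y m) (proj₁ (proj₁ m))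
      (maximal⇒saturated m) (proj₂ (proj₁ m))
    where
    go : ∀ {w ws} (s : Linked _⋖_ (w ∷ ws)) → All (Interval P x y) (w ∷ ws) → y ∈ w ∷ ws →
         Path w y ws (labels (w ∷ ws) s)
    go [-]     _               (here refl) = []
    go (c ∷ s) (_ ∷ I@(Iv ∷ _)) (here refl) = contradiction (<-≤-trans (proj₁ c) (proj₂ Iv)) <-irrefl
    go (c ∷ s) (_ ∷ I)         (there y∈)  = c ∷ go s I y∈

    start : ∀ {xs} → x ∈ xs → y ∈ xs → Linked _<_ xs → (s : Linked _⋖_ xs) →
            All (Interval P x y) xs → ∃ λ ws → xs ≡ x ∷ ws × Path x y ws (labels xs s)
    start (here refl) y∈ _ s I = _ , refl , go s I y∈
    start (there x∈) _ xs↗@(_ ∷ vs↗) _ ((x≤w , _) ∷ _) = contradiction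
      (≤-<-trans x≤w (All.lookup (Linked⇒All <-trans (Linked.head xs↗) vs↗) x∈)) <-irrefl

  Increasing : List L.Carrier → Set (c ⊔ o)
  Increasing = Linked L._≤_

  -- The counterpart of `ELInterval` for paths, with explicit label sequences in place of `labels`.
  -- It also makes sense for `x ≡ y`, which is needed when the second coordinate does not change
  -- along an interval of the product.
  record PathEL (x y : Carrier) : Set (a ⊔ ℓ ⊔ c ⊔ e ⊔ o) where
    field
      {vertices}   : List Carrier
      {sequence}   : List L.Carrier
      path         : Path x y vertices sequence
      increasing   : Increasing sequence
      unique       : ∀ {ws ls} → Path x y ws ls → Increasing ls → ws ≡ vertices
      precedes     : ∀ {ws ls} → Path x y ws ls → ws ≢ vertices → sequence ≺ ls

  pathEL-refl : ∀ {x} → PathEL x x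
  pathEL-refl = record
    { path       = []
    ; increasing = []
    ; unique     = λ p _ → proj₁ (path-loop p)
    ; precedes   = λ p ws≢[] → contradiction (proj₁ (path-loop p)) ws≢[]
    }

  elInterval⇒pathEL : ∀ {x y} → x ≤ y → ELInterval x y → PathEL x y
  elInterval⇒pathEL {x} {y} x≤y ((xs , (m , inc) , unique) , precedes)
    with maximalChain⇒path x≤y m
  ... | ws₀ , refl , p₀ = record
    { path       = p₀
    ; increasing = inc
    ; unique     = λ p ls↗ → sym (List.∷-injectiveʳ
        (unique (path⇒maximalChain p , subst Increasing (sym (path-labels p (path⇒linked p))) ls↗)))
    ; precedes   = λ p ws≢ → subst (_ ≺_) (path-labels p (path⇒linked p))
        (precedes _ (path⇒maximalChain p) λ eq → ws≢ (List.∷-injectiveʳ eq))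
    }

  pathEL⇒elInterval : ∀ {x y} → PathEL x y → ELInterval x y
  pathEL⇒elInterval {x} {y} el =
    (x ∷ vertices , (m , subst Increasing (sym eq) increasing) , unique′) , precedes′
    where
    open PathEL el

    m : MaximalChain P (Interval P x y) (x ∷ vertices)
    m = path⇒maximalChain path

    eq : labels (x ∷ vertices) (maximal⇒saturated m) ≡ sequence
    eq = path-labels path (path⇒linked path)

    unique′ : ∀ {ys} → RisingChain x y ys → x ∷ vertices ≡ ys
    unique′ (m′ , inc) with maximalChain⇒path (path-≤ path) m′
    ... | _ , refl , p = cong (x ∷_) (sym (unique p inc))

    precedes′ : ∀ ys (m′ : MaximalChain P (Interval P x y) ys) → ys ≢ x ∷ vertices →
                labels _ (maximal⇒saturated m) ≺ labels ys (maximal⇒saturated m′)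
    precedes′ ys m′ ys≢ with maximalChain⇒path (path-≤ path) m′
    ... | _ , refl , p = subst (_≺ _) (sym eq) (precedes p λ { refl → ys≢ refl })

-- Lexicographic comparison in products and under an adjoined minimum.

module Lexicographic (L : Poset c e o) where
  open Poset L

  infix 4 _<_ _≺_ _⊴_

  _<_ : Rel Carrier (e ⊔ o)
  _<_ = ToStrict._<_ _≈_ _≤_

  _≺_ : Rel (List Carrier) (c ⊔ e ⊔ o)
  _≺_ = Lex-< _≈_ _<_

  -- Lexicographic comparison, except that either list may be an initial segment
  -- of the other.
  data _⊴_ : Rel (List Carrier) (c ⊔ e ⊔ o) where
    []ˡ  : ∀ {ys} → [] ⊴ ys
    []ʳ  : ∀ {xs} → xs ⊴ []
    this : ∀ {x y xs ys} → x < y → x ∷ xs ⊴ y ∷ ys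
    next : ∀ {x y xs ys} → x ≈ y → xs ⊴ ys → x ∷ xs ⊴ y ∷ ys

  ≺⇒⊴ : ∀ {xs ys} → xs ≺ ys → xs ⊴ ys
  ≺⇒⊴ halt           = []ˡ
  ≺⇒⊴ (this x<y)     = this x<y
  ≺⇒⊴ (next x≈y xs≺) = next x≈y (≺⇒⊴ xs≺)

  ⊴-refl : ∀ {xs} → xs ⊴ xs
  ⊴-refl {[]}     = []ˡ
  ⊴-refl {_ ∷ xs} = next Eq.refl ⊴-refl

module _ (L₁ : Poset c₁ e₁ o₁) (L₂ : Poset c₂ e₂ o₂) where
  private
    module L₁ = Poset L₁
    module L₂ = Poset L₂
    module Lex₁ = Lexicographic L₁
    module Lex₂ = Lexicographic L₂
    module L× = Poset (×-poset L₁ L₂)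
    module Lex× = Lexicographic (×-poset L₁ L₂)

  -- The first index where either component differs decides: each component there is smaller or
  -- equal, and one of them is strictly smaller. Where the second components differ first, the first
  -- ones are still equal. The case where `xs` ends is settled by the first components, so `⊴` need
  -- not control lengths.
  ×-precedesˡ : ∀ xs ys → map proj₁ xs Lex₁.≺ map proj₁ ys → map proj₂ xs Lex₂.⊴ map proj₂ ys →
                xs Lex×.≺ ys
  ×-precedesˡ []       []       (base ())          _
  ×-precedesˡ []       (_ ∷ _)  _                  _             = halt
  ×-precedesˡ (_ ∷ _)  (_ ∷ _)  (this (a≤c , a≉c)) (Lex₂.this (b≤d , _)) =
    this ((a≤c , b≤d) , λ (a≈c , _) → a≉c a≈c)
  ×-precedesˡ (_ ∷ _)  (_ ∷ _)  (this (a≤c , a≉c)) (Lex₂.next b≈d _) =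
    this ((a≤c , L₂.reflexive b≈d) , λ (a≈c , _) → a≉c a≈c)
  ×-precedesˡ (_ ∷ _)  (_ ∷ _)  (next a≈c _) (Lex₂.this (b≤d , b≉d)) =
    this ((L₁.reflexive a≈c , b≤d) , λ (_ , b≈d) → b≉d b≈d)
  ×-precedesˡ (_ ∷ xs) (_ ∷ ys) (next a≈c p) (Lex₂.next b≈d q) =
    next (a≈c , b≈d) (×-precedesˡ xs ys p q)

  ×-precedesʳ : ∀ xs ys → map proj₁ xs ≡ map proj₁ ys → map proj₂ xs Lex₂.≺ map proj₂ ys →
                xs Lex×.≺ ys
  ×-precedesʳ []       []       _  (base ())
  ×-precedesʳ []       (_ ∷ _)  () _
  ×-precedesʳ (_ ∷ xs) (_ ∷ ys) eq (this (b≤d , b≉d)) =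
    this ((L₁.reflexive a≈c , b≤d) , λ (_ , b≈d) → b≉d b≈d)
    where a≈c = L₁.Eq.reflexive (List.∷-injectiveˡ eq)
  ×-precedesʳ (_ ∷ xs) (_ ∷ ys) eq (next b≈d p) =
    next (L₁.Eq.reflexive (List.∷-injectiveˡ eq) , b≈d)
      (×-precedesʳ xs ys (List.∷-injectiveʳ eq) p)

  ×-increasing⁺ : ∀ xs → Linked L₁._≤_ (map proj₁ xs) → Linked L₂._≤_ (map proj₂ xs) →
                  Linked L×._≤_ xs
  ×-increasing⁺ []           _        _        = []
  ×-increasing⁺ (_ ∷ [])     _        _        = [-]
  ×-increasing⁺ (_ ∷ _ ∷ xs) (p ∷ ps) (q ∷ qs) = (p , q) ∷ ×-increasing⁺ (_ ∷ xs) ps qs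

  ×-increasingˡ : ∀ {xs} → Linked L×._≤_ xs → Linked L₁._≤_ (map proj₁ xs)
  ×-increasingˡ []       = []
  ×-increasingˡ [-]      = [-]
  ×-increasingˡ (p ∷ ps) = proj₁ p ∷ ×-increasingˡ ps

  ×-increasingʳ : ∀ {xs} → Linked L×._≤_ xs → Linked L₂._≤_ (map proj₂ xs)
  ×-increasingʳ []       = []
  ×-increasingʳ [-]      = [-]
  ×-increasingʳ (p ∷ ps) = proj₂ p ∷ ×-increasingʳ ps

module _ (L : Poset c e o) where
  private
    module L = Poset L
    module L₋ = Poset (withMinimum L)
    module Lex = Lexicographic L
    module Lex₋ = Lexicographic (withMinimum L)

  []₋-≺ : ∀ {xs ys} → xs Lex.≺ ys → map [_]₋ xs Lex₋.≺ map [_]₋ ys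
  []₋-≺ halt                 = halt
  []₋-≺ (this (x≤y , x≉y))   = this ([ x≤y ] , x≉y ∘ [≈]-injective L._≈_)
  []₋-≺ (next x≈y p)         = next [ x≈y ] ([]₋-≺ p)

  []₋-increasing⁺ : ∀ {xs} → Linked L._≤_ xs → Linked L₋._≤_ (map [_]₋ xs)
  []₋-increasing⁺ []       = []
  []₋-increasing⁺ [-]      = [-]
  []₋-increasing⁺ (p ∷ ps) = [ p ] ∷ []₋-increasing⁺ ps

  []₋-increasing⁻ : ∀ xs → Linked L₋._≤_ (map [_]₋ xs) → Linked L._≤_ xs
  []₋-increasing⁻ []           _        = []
  []₋-increasing⁻ (_ ∷ [])     _        = [-]
  []₋-increasing⁻ (_ ∷ _ ∷ xs) (p ∷ ps) = [≤]-injective L._≤_ p ∷ []₋-increasing⁻ (_ ∷ xs) ps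

  ⊥₋∷-increasing : ∀ {xs} → Linked L₋._≤_ xs → Linked L₋._≤_ (⊥₋ ∷ xs)
  ⊥₋∷-increasing {[]}    _  = [-]
  ⊥₋∷-increasing {x ∷ _} ps = (⊥₋≤ x) ∷ ps

  ⊥₋<[] : ∀ {x} → ⊥₋ Lex₋.< [ x ]₋
  ⊥₋<[] = (⊥₋≤ _) , λ ()

  -- Chains up to the adjoined maximum may have different lengths, hence the arbitrary length of
  -- `ys`.
  replicate-⊥₋-⊴ : ∀ n ys → replicate n ⊥₋ Lex₋.⊴ ys
  replicate-⊥₋-⊴ zero    _             = Lex₋.[]ˡ
  replicate-⊥₋-⊴ (suc n) []            = Lex₋.[]ʳ
  replicate-⊥₋-⊴ (suc n) (⊥₋ ∷ ys)     = Lex₋.next ⊥₋≈⊥₋ (replicate-⊥₋-⊴ n ys)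
  replicate-⊥₋-⊴ (suc n) ([ _ ]₋ ∷ ys) = Lex₋.this ⊥₋<[]

-- Saturated chains with repetitions in the second factor.

module LazyPaths (Q : FinPoset a ℓ) (sQ : Semipure Q)
                 (L : Poset c e o) (lab : EdgeLabeling Q L) where
  open FinPoset Q
  open FinPosetProperties Q
  open SemipureProperties Q sQ
  open Semipure sQ
  open Paths Q L lab
  private
    module L = Poset L
    module L₋ = Poset (withMinimum L)
    module Lex₋ = Lexicographic (withMinimum L)

  -- The second coordinates of a saturated chain of the Rees product.
  data LazyPath : Carrier → Carrier → List Carrier → List (L.Carrier ₋) → Set (a ⊔ ℓ ⊔ c) where
    []   : ∀ {k} → LazyPath k k [] []
    stay : ∀ {k l ks bs} → LazyPath k l ks bs → LazyPath k l (k ∷ ks) (⊥₋ ∷ bs)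
    move : ∀ {j k l ks bs} (j⋖k : j ⋖ k) → LazyPath k l ks bs →
           LazyPath j l (k ∷ ks) ([ lab j k j⋖k ]₋ ∷ bs)

  -- Covers are strict, so a repeated vertex can only come from `stay` and a new one only from
  -- `move`.
  lazy-unique : ∀ {k l l′ ks ks′ bs bs′} → ks ≡ ks′ → LazyPath k l ks bs → LazyPath k l′ ks′ bs′ →
                l ≡ l′ × bs ≡ bs′
  lazy-unique refl []         []         = refl , refl
  lazy-unique refl (stay p)   (stay q)   with lazy-unique refl p q
  ... | refl , refl = refl , refl
  lazy-unique refl (move _ p) (move _ q) with lazy-unique refl p q
  ... | refl , refl = refl , refl
  lazy-unique refl (stay _)   (move c _) = contradiction (proj₁ c) <-irrefl
  lazy-unique refl (move c _) (stay _)   = contradiction (proj₁ c) <-irrefl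

  path-length : ∀ {x y ws ls} → Path x y ws ls → length ws + rank x ≡ rank y
  path-length []                  = refl
  path-length {x} (_∷_ {y = w} {ws = ws} c p) = trans (sym (ℕ.+-suc (length ws) (rank x)))
    (trans (cong (length ws +_) (sym (rank-⋖ c))) (path-length p))

  private
    move-rank : ∀ {x y} n → x ⋖ y → n + rank y ≡ suc (n + rank x)
    move-rank {x} n c = trans (cong (n +_) (rank-⋖ c)) (ℕ.+-suc n (rank x))

  -- Each step raises the rank by at most one.
  lazy-length : ∀ {k l ks bs} → LazyPath k l ks bs → rank l ≤ℕ length ks + rank k
  lazy-length []                    = ℕ.≤-refl
  lazy-length (stay p)              = ℕ.m≤n⇒m≤1+n (lazy-length p)
  lazy-length {l = l} (move {ks = ks} c p) =
    subst (rank l ≤ℕ_) (move-rank (length ks) c) (lazy-length p)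

  path⇒lazy : ∀ {k l ks bs} → Path k l ks bs → ∀ m →
              LazyPath k l (replicate m k ++ ks) (replicate m ⊥₋ ++ map [_]₋ bs)
  path⇒lazy []      zero    = []
  path⇒lazy (c ∷ p) zero    = move c (path⇒lazy p zero)
  path⇒lazy p       (suc m) = stay (path⇒lazy p m)

  -- With no step to spare, a `stay` would leave too few steps to reach the rank of `l`.
  tight⇒path : ∀ {k l ks bs} → LazyPath k l ks bs → length ks + rank k ≡ rank l →
               ∃ λ ls → bs ≡ map [_]₋ ls × Path k l ks ls
  tight⇒path []         _  = [] , refl , []
  tight⇒path {l = l} (stay p) eq = contradiction (lazy-length p) (ℕ.<⇒≱ (ℕ.≤-reflexive eq))
  tight⇒path (move {ks = ks} c p) eq with tight⇒path p (trans (move-rank (length ks) c) eq)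
  ... | ls , refl , q = _ , refl , c ∷ q

  private
    -- In a weakly increasing sequence `⊥₋` cannot follow a label of `L`, so after one move every
    -- later step is a move and raises the rank by one.
    only-moves : ∀ {k l ks bs b} → LazyPath k l ks bs → Linked L₋._≤_ ([ b ]₋ ∷ bs) →
                 length ks + rank k ≡ rank l
    only-moves []                   _        = refl
    only-moves (stay p)             (() ∷ _)
    only-moves (move {ks = ks} c p) (_ ∷ bs) = trans (sym (move-rank (length ks) c)) (only-moves p bs)

  module _ {k l} (E : PathEL k l) where
    open PathEL E

    lazy-increasing : ∀ m → Linked L₋._≤_ (replicate m ⊥₋ ++ map [_]₋ sequence)
    lazy-increasing zero    = []₋-increasing⁺ L increasing
    lazy-increasing (suc m) = ⊥₋∷-increasing L (lazy-increasing m)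

    -- The length equation says that exactly `m` steps are rests. A move made while rests are
    -- outstanding would exclude them for good by `only-moves`, so the rests come first; what
    -- remains is an increasing path in `Q`.
    lazy-increasing-unique : ∀ m {ks bs} → LazyPath k l ks bs →
                             length ks + rank k ≡ m + rank l → Linked L₋._≤_ bs →
                             ks ≡ replicate m k ++ vertices
    lazy-increasing-unique zero p eq bs↗ with tight⇒path p eq
    ... | ls , refl , q = unique q ([]₋-increasing⁻ L ls bs↗)
    lazy-increasing-unique (suc m) []       eq bs↗ = contradiction eq (ℕ.m≢1+n+m _)
    lazy-increasing-unique (suc m) (stay p) eq bs↗ =
      cong (k ∷_) (lazy-increasing-unique m p (ℕ.suc-injective eq) (Linked.tail bs↗))
    lazy-increasing-unique (suc m) (move {ks = ks} c p) eq bs↗ =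
      contradiction (trans (sym (only-moves p bs↗)) (trans (move-rank (length ks) c) eq))
        (ℕ.m≢1+n+m _)

    -- A chain that moves during the first `m` steps has a label above `⊥₋` there and loses at once.
    -- Otherwise it rests `m` times and continues as a path in `Q`, where `precedes` applies.
    lazy-precedes : ∀ m {ks bs} → LazyPath k l ks bs → length ks + rank k ≡ m + rank l →
                    ks ≢ replicate m k ++ vertices →
                    replicate m ⊥₋ ++ map [_]₋ sequence Lex₋.≺ bs
    lazy-precedes zero p eq ks≢ with tight⇒path p eq
    ... | ls , refl , q = []₋-≺ L (precedes q ks≢)
    lazy-precedes (suc m) []         eq ks≢ = contradiction eq (ℕ.m≢1+n+m _)
    lazy-precedes (suc m) (stay p)   eq ks≢ =
      next ⊥₋≈⊥₋ (lazy-precedes m p (ℕ.suc-injective eq) (ks≢ ∘ cong (k ∷_)))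
    lazy-precedes (suc m) (move _ _) eq ks≢ = this (⊥₋<[] L)

  lazy-constant : ∀ {k l ks bs} n → LazyPath k l ks bs → bs ≡ replicate n ⊥₋ → ks ≡ replicate n k
  lazy-constant zero    []       refl = refl
  lazy-constant (suc n) (stay p) eq   = cong (_ ∷_) (lazy-constant n p (List.∷-injectiveʳ eq))

  constant-precedes : ∀ {k l ks bs} → LazyPath k l ks bs → ks ≢ replicate (length ks) k →
                      replicate (length ks) ⊥₋ Lex₋.≺ bs
  constant-precedes []         ks≢ = contradiction refl ks≢
  constant-precedes (stay p)   ks≢ = next ⊥₋≈⊥₋ (constant-precedes p (ks≢ ∘ cong (_ ∷_)))
  constant-precedes (move _ _) _   = this (⊥₋<[] L)

-- Chains of the Rees product and their two coordinates.

module ReesPaths (P : FinPoset a₁ ℓ₁) (Q : FinPoset a₂ ℓ₂) (sP : Semipure P) (sQ : Semipure Q)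
                 (0̂ : FinPoset.Carrier Q) (0̂-min : Minimum (FinPoset._≤_ Q) 0̂)
                 (L₁ : Poset c₁ e₁ o₁) (L₂ : Poset c₂ e₂ o₂)
                 (λ₁ : EdgeLabeling (hat P) L₁) (λ₂ : EdgeLabeling Q L₂) where

  open Rees P Q sP sQ hiding (_≤_)
  open HatCovers 0̂ 0̂-min
  open Semipure sP using () renaming (rank to rP)
  open Semipure sQ using () renaming (rank to rQ)
  open Poset (withMinimum L₂) using () renaming (_≤_ to _≤₂_)

  private
    module P   = FinPoset P
    module Q   = FinPoset Q
    module P̂   = FinPoset (hat P)
    module R̂   = FinPoset (hat reesProduct)
    module PS  = SemipureProperties P sP
    module QS  = SemipureProperties Q sQ
    module HP  = HatProperties P
    module HR  = HatProperties reesProduct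

    label : EdgeLabeling (hat reesProduct) (×-poset L₁ (withMinimum L₂))
    label = reesLabeling P Q sP sQ 0̂ 0̂-min L₁ L₂ λ₁ λ₂

    snd-label : ∀ k l → .(k ≡ l ⊎ k Q.⋖ l) → Poset.Carrier L₂ ₋
    snd-label = secondLabel P Q sP sQ 0̂ 0̂-min L₁ L₂ λ₁ λ₂

    module Lex₂ = Lexicographic (withMinimum L₂)

  module Path₁ = Paths (hat P) L₁ λ₁
  module Path₂ = Paths Q L₂ λ₂
  module PathR = Paths (hat reesProduct) (×-poset L₁ (withMinimum L₂)) label
  open LazyPaths Q sQ L₂ λ₂
  open Path₁ using () renaming ([] to []₁; _∷_ to _∷₁_)
  open Path₂ using () renaming ([] to []₂; _∷_ to _∷₂_)
  open PathR using () renaming ([] to []ᵣ; _∷_ to _∷ᵣ_)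

  -- ⊤± has no second coordinate of its own and inherits that of its predecessor
  -- in a chain.
  carry : Q.Carrier → Element ± → Q.Carrier
  carry k ⊥±     = 0̂
  carry k [ u ]± = snd u
  carry k ⊤±     = k

  seconds : Q.Carrier → List (Element ±) → List Q.Carrier
  seconds k []       = []
  seconds k (w ∷ ws) = carry k w ∷ seconds (carry k w) ws

  carry-idem : ∀ k w → carry (carry k w) w ≡ carry k w
  carry-idem k ⊥±     = refl
  carry-idem k [ _ ]± = refl
  carry-idem k ⊤±     = refl

  length-seconds : ∀ k ws → length (seconds k ws) ≡ length ws
  length-seconds k []       = refl
  length-seconds k (w ∷ ws) = cong suc (length-seconds (carry k w) ws)

  fst^-carry-injective : ∀ {k} u v → fst^ u ≡ fst^ v → carry k u ≡ carry k v → u ≡ v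
  fst^-carry-injective ⊥±     ⊥±     _    _ = refl
  fst^-carry-injective ⊤±     ⊤±     _    _ = refl
  fst^-carry-injective ⊤±     [ _ ]± ()   _
  fst^-carry-injective [ u ]± [ v ]± refl e = cong [_]± (element-≡ refl e)

  coordinates-injective : ∀ k {us vs} → map fst^ us ≡ map fst^ vs → seconds k us ≡ seconds k vs →
                          us ≡ vs
  coordinates-injective k {[]}     {[]}     _ _ = refl
  coordinates-injective k {u ∷ us} {v ∷ vs} p q
    with fst^-carry-injective {k} u v (List.∷-injectiveˡ p) (List.∷-injectiveˡ q)
  ... | refl = cong (u ∷_)
    (coordinates-injective (carry k u) (List.∷-injectiveʳ p) (List.∷-injectiveʳ q))

  fst^-< : ∀ {u v} → u R̂.< v → fst^ u P̂.< fst^ v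
  fst^-< {_}      {⊥±}     u<v = contradiction u<v HR.≮⊥
  fst^-< {⊤±}     {_}      u<v = contradiction u<v HR.⊤≮
  fst^-< {⊥±}     {[ _ ]±} _   = HP.⊥<[]
  fst^-< {⊥±}     {⊤±}     _   = HP.⊥<⊤
  fst^-< {[ _ ]±} {[ _ ]±} u<v = HP.[<]⁺ (<-fst (HR.[<]-injective u<v))
  fst^-< {[ _ ]±} {⊤±}     _   = HP.[]<⊤

  -- `fst^` is strictly monotone, so anything strictly between `u` and `v` would project strictly
  -- inside the cover.
  ⋖-fst^⁻ : ∀ {u v} → u R̂.< v → fst^ u P̂.⋖ fst^ v → u R̂.⋖ v
  ⋖-fst^⁻ u<v (_ , gap) = u<v , λ z (u<z , z<v) → gap (fst^ z) (fst^-< u<z , fst^-< z<v)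

  first-path : ∀ {u v ws ls} → PathR.Path u v ws ls →
               Path₁.Path (fst^ u) (fst^ v) (map fst^ ws) (map proj₁ ls)
  first-path []ᵣ      = []₁
  first-path (_∷ᵣ_ {u} {w} c p) = step u w c (first-path p)
    where
    -- `label u w c` reduces only after both ends are split into cases.
    step : ∀ u w {y as ls} (c : u R̂.⋖ w) → Path₁.Path (fst^ w) y as ls →
           Path₁.Path (fst^ u) y (fst^ w ∷ as) (proj₁ (label u w c) ∷ ls)
    step _      ⊥±     c p = contradiction (proj₁ c) HR.≮⊥
    step ⊤±     [ _ ]± c p = contradiction (proj₁ c) HR.⊤≮
    step ⊤±     ⊤±     c p = contradiction (proj₁ c) HR.⊤≮
    step ⊥±     [ _ ]± c p = ⋖-fst^ c ∷₁ p
    step [ _ ]± [ _ ]± c p = ⋖-fst^ c ∷₁ p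
    step ⊥±     ⊤±     c p = ⋖-fst^ c ∷₁ p
    step [ _ ]± ⊤±     c p = ⋖-fst^ c ∷₁ p

  private
    lazy-step : ∀ {k l m ks bs} (c : k ≡ l ⊎ k Q.⋖ l) → LazyPath l m ks bs →
                LazyPath k m (l ∷ ks) (snd-label k l c ∷ bs)
    lazy-step {k} {l} c p with k Q.≟ l
    lazy-step c          p | yes refl = stay p
    lazy-step (inj₁ k≡l) p | no k≢l = contradiction k≡l k≢l
    lazy-step (inj₂ k⋖l) p | no _ = move k⋖l p

  -- The final second coordinate `l` is existential because `v` may be `⊤±`; when `v` is an element,
  -- `carry l v ≡ l` identifies `l` with its second coordinate.
  second-path : ∀ {u v ws ls} k → carry k u ≡ k → PathR.Path u v ws ls →
                ∃ λ l → LazyPath k l (seconds k ws) (map proj₂ ls) × carry l v ≡ l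
  second-path k eq []ᵣ = k , [] , eq
  second-path k eq (_∷ᵣ_ {u} {w} c p) with second-path (carry k w) (carry-idem k w) p
  ... | l , q , eq′ = l , step u w eq c q , eq′
    where
    step : ∀ u w {l ks bs} → carry k u ≡ k → (c : u R̂.⋖ w) → LazyPath (carry k w) l ks bs →
           LazyPath k l (carry k w ∷ ks) (proj₂ (label u w c) ∷ bs)
    step _      ⊥±     _    c p = contradiction (proj₁ c) HR.≮⊥
    step ⊤±     [ _ ]± _    c p = contradiction (proj₁ c) HR.⊤≮
    step ⊤±     ⊤±     _    c p = contradiction (proj₁ c) HR.⊤≮
    step ⊥±     [ _ ]± refl c p = lazy-step (inj₁ (⊥⋖-snd c)) p
    step [ _ ]± [ _ ]± refl c p = lazy-step ([]⋖-snd c) p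
    step ⊥±     ⊤±     _    c p = stay p
    step [ _ ]± ⊤±     _    c p = stay p

  -- Lifting pairs of coordinate chains to the product.

  private
    rQ-0̂ : rQ 0̂ ≡ 0
    rQ-0̂ = QS.rank-minimal λ z (z≤0̂ , z≢0̂) → z≢0̂ (Q.antisym z≤0̂ (0̂-min z))

    extend-≤ : ∀ {p q} (u : Element) (c : fst u P.⋖ p) → rQ q ≤ℕ suc (rQ (snd u)) → rQ q ≤ℕ rP p
    extend-≤ u c r = ℕ.≤-trans r (subst (suc (rQ (snd u)) ≤ℕ_) (sym (PS.rank-⋖ c)) (s≤s (rank≥ u)))

    extend-< : ∀ {p q} (u : Element) (c : fst u P.⋖ p) (r : rQ q ≤ℕ suc (rQ (snd u))) →
               snd u Q.≤ q → [ u ]± R̂.< [ element p q (extend-≤ u c r) ]±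
    extend-< {p} {q} u c r u≤q = HR.[<]⁺
      ( (proj₁ (proj₁ c) , u≤q , subst (rQ q + rP (fst u) ≤ℕ_) eq (ℕ.+-monoˡ-≤ (rP (fst u)) r))
      , fst-≢ (proj₁ c))
      where
      eq : suc (rQ (snd u)) + rP (fst u) ≡ rP p + rQ (snd u)
      eq = trans (cong suc (ℕ.+-comm (rQ (snd u)) _)) (cong (_+ rQ (snd u)) (sym (PS.rank-⋖ c)))

  -- Raising the first coordinate keeps the rank condition intact, so resting in the second
  -- coordinate is always possible.
  stay-cover : ∀ {k p} u → carry k u ≡ k → fst^ u P̂.⋖ p →
               ∃ λ w → fst^ w ≡ p × carry k w ≡ k × u R̂.⋖ w
  stay-cover {p = ⊥±}     _      _    c = contradiction (proj₁ c) HP.≮⊥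
  stay-cover {p = [ _ ]±} ⊤±     _    c = contradiction (proj₁ c) HP.⊤≮
  stay-cover {p = ⊤±}     ⊤±     _    c = contradiction (proj₁ c) HP.⊤≮
  stay-cover {p = ⊤±}     ⊥±     refl c = ⊤± , refl , refl , ⋖-fst^⁻ HR.⊥<⊤ c
  stay-cover {p = ⊤±}     [ u ]± refl c = ⊤± , refl , refl , ⋖-fst^⁻ HR.[]<⊤ c
  stay-cover {p = [ p ]±} ⊥±     refl c =
    [ element p 0̂ (subst (_≤ℕ rP p) (sym rQ-0̂) z≤n) ]± , refl , refl , ⋖-fst^⁻ HR.⊥<[] c
  stay-cover {p = [ p ]±} [ u ]± refl c =
    _ , refl , refl , ⋖-fst^⁻ (extend-< u (HP.[]⋖[]⁻ c) (ℕ.n≤1+n _) Q.≤-refl) c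

  move-cover : ∀ {p q} u → [ fst u ]± P̂.⋖ [ p ]± → snd u Q.⋖ q →
               ∃ λ w → fst w ≡ p × snd w ≡ q × [ u ]± R̂.⋖ [ w ]±
  move-cover u c d = _ , refl , refl ,
    ⋖-fst^⁻ (extend-< u (HP.[]⋖[]⁻ c) (ℕ.≤-reflexive (QS.rank-⋖ d)) (proj₁ (proj₁ d))) c

  -- Only the first coordinate of `end` is prescribed. Its second coordinate, if it has one, is
  -- recovered later from `seconds-≡`.
  record Lift (k : Q.Carrier) (u : Element ±) (y : P.Carrier ±)
              (as : List (P.Carrier ±)) (ks : List Q.Carrier) :
              Set (a₁ ⊔ ℓ₁ ⊔ a₂ ⊔ ℓ₂ ⊔ c₁ ⊔ c₂) where
    field
      {end}      : Element ±
      {vertices} : List (Element ±)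
      {sequence} : List (Poset.Carrier (×-poset L₁ (withMinimum L₂)))
      path       : PathR.Path u end vertices sequence
      end-fst    : fst^ end ≡ y
      firsts     : map fst^ vertices ≡ as
      seconds-≡  : seconds k vertices ≡ ks

  lift-∷ : ∀ {k k′ u w y as ks} → u R̂.⋖ w → carry k w ≡ k′ → Lift k′ w y as ks →
           Lift k u y (fst^ w ∷ as) (k′ ∷ ks)
  lift-∷ c refl r = record
    { path      = c ∷ᵣ path
    ; end-fst   = end-fst
    ; firsts    = cong (_ ∷_) firsts
    ; seconds-≡ = cong (_ ∷_) seconds-≡
    }
    where open Lift r

  constant-lift : ∀ {k y as A} u → carry k u ≡ k → Path₁.Path (fst^ u) y as A →
                  Lift k u y as (replicate (length as) k)
  constant-lift u eq []₁ =
    record { path = []ᵣ ; end-fst = refl ; firsts = refl ; seconds-≡ = refl }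
  constant-lift u eq (c ∷₁ p) with stay-cover u eq c
  ... | w , refl , eq′ , d = lift-∷ d eq′ (constant-lift w eq′ p)

  -- The first coordinate advances at every step, the second only after `m` rests; the length
  -- equation makes both chains end together.
  element-lift : ∀ m (u : Element) {y l as A qs B} → Path₁.Path [ fst u ]± [ y ]± as A →
                 Path₂.Path (snd u) l qs B → length as ≡ m + length qs →
                 Lift (snd u) [ u ]± [ y ]± as (replicate m (snd u) ++ qs)
  element-lift zero    u []₁ []₂ eq =
    record { path = []ᵣ ; end-fst = refl ; firsts = refl ; seconds-≡ = refl }
  element-lift zero    u (_∷₁_ {y = ⊥±} c p) (d ∷₂ q) eq = contradiction (proj₁ c) HP.≮⊥
  element-lift zero    u (_∷₁_ {y = ⊤±} c p) (d ∷₂ q) eq =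
    contradiction (Path₁.path-≤ p , λ ()) HP.⊤≮
  element-lift zero    u (_∷₁_ {y = [ _ ]±} c p) (d ∷₂ q) eq with move-cover u c d
  ... | w , refl , refl , c′ = lift-∷ c′ refl (element-lift zero w p q (ℕ.suc-injective eq))
  element-lift (suc m) u (_∷₁_ {y = ⊥±} c p) q eq = contradiction (proj₁ c) HP.≮⊥
  element-lift (suc m) u (_∷₁_ {y = ⊤±} c p) q eq =
    contradiction (Path₁.path-≤ p , λ ()) HP.⊤≮
  element-lift (suc m) u (_∷₁_ {y = [ _ ]±} c p) q eq with stay-cover [ u ]± refl c
  ... | [ w ]± , refl , refl , c′ = lift-∷ c′ refl (element-lift m w p q (ℕ.suc-injective eq))

  -- Atoms of the hat of the product have second coordinate `0̂`, so the first step out of `⊥±` is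
  -- always a rest; hence `suc m`.
  bottom-lift : ∀ m {y l as A qs B} → Path₁.Path ⊥± [ y ]± as A →
                Path₂.Path 0̂ l qs B → length as ≡ suc m + length qs →
                Lift 0̂ ⊥± [ y ]± as (replicate (suc m) 0̂ ++ qs)
  bottom-lift m (_∷₁_ {y = ⊥±} c p) q eq = contradiction (proj₁ c) HP.≮⊥
  bottom-lift m (_∷₁_ {y = ⊤±} c p) q eq =
    contradiction (Path₁.path-≤ p , λ ()) HP.⊤≮
  bottom-lift m (_∷₁_ {y = [ _ ]±} c p) q eq with stay-cover ⊥± refl c
  ... | [ w ]± , refl , refl , c′ = lift-∷ c′ refl (element-lift m w p q (ℕ.suc-injective eq))

  -- Lengths, and the EL property from the coordinates.

  rank^ : P.Carrier ± → ℕ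
  rank^ ⊥±     = 0
  rank^ [ x ]± = suc (rP x)
  -- A default value: chains below `⊤±` need not have equal length, and `first-length` concerns only
  -- chains ending at an element of `P`.
  rank^ ⊤±     = 0

  first-length : ∀ {x y as A} → Path₁.Path x [ y ]± as A → length as + rank^ x ≡ suc (rP y)
  first-length []₁ = refl
  first-length (_∷₁_ {ws = as} c p) =
    trans (sym (ℕ.+-suc (length as) _))
      (trans (cong (length as +_) (sym (step c (Path₁.path-≤ p)))) (first-length p))
    where
    step : ∀ {x w y} → x P̂.⋖ w → w P̂.≤ [ y ]± → rank^ w ≡ suc (rank^ x)
    step {_}      {⊥±}     c         _   = contradiction (proj₁ c) HP.≮⊥
    step {⊤±}     {_}      c         _   = contradiction (proj₁ c) HP.⊤≮
    step {_}      {⊤±}     _         w≤y = contradiction (w≤y , λ ()) HP.⊤≮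
    step {⊥±}     {[ _ ]±} (_ , gap) _   =
      cong suc (PS.rank-minimal λ z z<w → gap [ z ]± (HP.⊥<[] , HP.[<]⁺ z<w))
    step {[ _ ]±} {[ _ ]±} c         _   = cong suc (PS.rank-⋖ (HP.[]⋖[]⁻ c))

  -- The step into `⊤±` has second label `⊥₋`, and nothing but `⊥₋` can precede it in a weakly
  -- increasing sequence.
  top-sequence : ∀ {u ws ls} → PathR.Path u ⊤± ws ls → Linked _≤₂_ (map proj₂ ls) →
                 map proj₂ ls ≡ replicate (length ws) ⊥₋
  top-sequence []ᵣ     _   = refl
  top-sequence {u = ⊤±}     (c ∷ᵣ []ᵣ) _ = contradiction (proj₁ c) HR.⊤≮
  top-sequence {u = ⊥±}     (c ∷ᵣ []ᵣ) _ = refl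
  top-sequence {u = [ _ ]±} (c ∷ᵣ []ᵣ) _ = refl
  top-sequence (c ∷ᵣ d ∷ᵣ p) (b≤ ∷ bs↗) with top-sequence (d ∷ᵣ p) bs↗
  ... | eq = cong₂ _∷_ (minimal (subst (_ ≤₂_) (List.∷-injectiveˡ eq) b≤)) eq
    where
    minimal : ∀ {b} → b ≤₂ ⊥₋ → b ≡ ⊥₋
    minimal (⊥₋≤ _) = refl

  -- The candidate `r` lies over the increasing chain of first coordinates. The last three
  -- hypotheses cover the second labels: uniqueness over that chain, weak comparison with every
  -- chain, and strict comparison with chains over the same first coordinates.
  pathEL : ∀ {k u v ks} (E : Path₁.PathEL (fst^ u) (fst^ v)) →
           (r : Lift k u (fst^ v) (Path₁.PathEL.vertices E) ks) → Lift.end r ≡ v →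
           Linked _≤₂_ (map proj₂ (Lift.sequence r)) →
           (∀ {ws ls} → PathR.Path u v ws ls → map fst^ ws ≡ Path₁.PathEL.vertices E →
              Linked _≤₂_ (map proj₂ ls) → seconds k ws ≡ ks) →
           (∀ {ws ls} → PathR.Path u v ws ls →
              map proj₂ (Lift.sequence r) Lex₂.⊴ map proj₂ ls) →
           (∀ {ws ls} → PathR.Path u v ws ls → map fst^ ws ≡ Path₁.PathEL.vertices E →
              seconds k ws ≢ ks → map proj₂ (Lift.sequence r) Lex₂.≺ map proj₂ ls) →
           PathR.PathEL u v
  pathEL {k} {ks = ks} E r refl increasing₂ unique₂ weak₂ precedes₂ = record
    { path       = r.path
    ; increasing = ×-increasing⁺ L₁ (withMinimum L₂) _
        (subst Path₁.Increasing (sym first-sequence) E.increasing) increasing₂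
    ; unique     = λ p ls↗ →
        let eq = E.unique (first-path p) (×-increasingˡ L₁ (withMinimum L₂) ls↗)
        in equal eq (unique₂ p eq (×-increasingʳ L₁ (withMinimum L₂) ls↗))
    ; precedes   = precedes
    }
    where
    module E = Path₁.PathEL E
    module r = Lift r

    first-sequence : map proj₁ r.sequence ≡ E.sequence
    first-sequence = Path₁.labels-unique r.firsts (first-path r.path) E.path

    equal : ∀ {ws} → map fst^ ws ≡ E.vertices → seconds k ws ≡ ks → ws ≡ r.vertices
    equal eq eq′ = coordinates-injective k (trans eq (sym r.firsts)) (trans eq′ (sym r.seconds-≡))

    precedes : ∀ {ws ls} → PathR.Path _ _ ws ls → ws ≢ r.vertices →
               Lexicographic._≺_ (×-poset L₁ (withMinimum L₂)) r.sequence ls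
    -- If the first coordinates agree, the second ones differ and decide; otherwise the first labels
    -- are strictly smaller and weak comparison of the second ones suffices.
    precedes {ws} {ls} p ws≢ with List.≡-dec P̂._≟_ (map fst^ ws) E.vertices
    ... | yes eq = ×-precedesʳ L₁ (withMinimum L₂) _ _
      (trans first-sequence (Path₁.labels-unique (sym eq) E.path (first-path p)))
      (precedes₂ p eq (ws≢ ∘ equal eq))
    ... | no fs≢ = ×-precedesˡ L₁ (withMinimum L₂) _ _
      (subst (λ s → Lexicographic._≺_ L₁ s (map proj₁ ls)) (sym first-sequence)
        (E.precedes (first-path p) fs≢))
      (weak₂ p)

  -- The increasing chain rests throughout. Strict comparison of second labels is needed only over
  -- the same first coordinates, where the lengths agree.
  pathEL-top : ∀ {k} u → carry k u ≡ k → Path₁.PathEL (fst^ u) ⊤± → PathR.PathEL u ⊤±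
  pathEL-top {k} u eq E = pathEL E r (end-top r.end-fst)
    (subst (Linked _≤₂_) (sym r-second) (constant-increasing n))
    (λ p firsts bs↗ → trans
      (lazy-constant _ (proj₁ (proj₂ (second-path k eq p))) (top-sequence p bs↗))
      (cong (λ n → replicate n k) (ws-length firsts)))
    (λ p → subst (Lex₂._⊴ _) (sym r-second) (replicate-⊥₋-⊴ L₂ n _))
    (λ {ws} p firsts ks≢ →
      let len = trans (length-seconds k ws) (ws-length firsts) in
      subst (Lex₂._≺ _) (trans (cong (λ n → replicate n ⊥₋) len) (sym r-second))
        (constant-precedes (proj₁ (proj₂ (second-path k eq p)))
          (λ e → ks≢ (trans e (cong (λ n → replicate n k) len)))))
    where
    module E = Path₁.PathEL E

    n : ℕ
    n = length E.vertices

    r : Lift k u ⊤± E.vertices (replicate n k)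
    r = constant-lift u eq E.path
    module r = Lift r

    end-top : ∀ {w} → fst^ w ≡ ⊤± → w ≡ ⊤±
    end-top {[ _ ]±} ()
    end-top {⊤±}     _ = refl

    ws-length : ∀ {ws} → map fst^ ws ≡ E.vertices → length ws ≡ n
    ws-length {ws} firsts = trans (sym (List.length-map fst^ ws)) (cong length firsts)

    constant-increasing : ∀ n → Linked _≤₂_ (replicate n ⊥₋)
    constant-increasing zero    = []
    constant-increasing (suc n) = ⊥₋∷-increasing L₂ (constant-increasing n)

    constant : ∀ n → LazyPath k k (replicate n k) (replicate n ⊥₋)
    constant zero    = []
    constant (suc n) = stay (constant n)

    r-second : map proj₂ r.sequence ≡ replicate n ⊥₋
    r-second =
      proj₂ (lazy-unique r.seconds-≡ (proj₁ (proj₂ (second-path k eq r.path))) (constant n))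

  -- By `first-length` all chains from `u` to `[ v ]±` have the same length, so each of them rests
  -- exactly `m` times and the results on lazy paths apply to all.
  pathEL-element : ∀ {k} u v m (E : Path₁.PathEL (fst^ u) [ fst v ]±) (F : Path₂.PathEL k (snd v)) →
                   carry k u ≡ k →
                   length (Path₁.PathEL.vertices E) + rQ k ≡ m + rQ (snd v) →
                   Lift k u [ fst v ]± (Path₁.PathEL.vertices E)
                     (replicate m k ++ Path₂.PathEL.vertices F) →
                   PathR.PathEL u [ v ]±
  pathEL-element {k} u v m E F eq len r = pathEL E r
    (end-v r.end-fst (proj₁ lazy-data) (proj₂ (proj₂ (second-path k eq r.path))))
    (subst (Linked _≤₂_) (sym (proj₂ lazy-data)) (lazy-increasing F m))
    (λ p _ → lazy-increasing-unique F m (second p) (second-length p))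
    weak
    (λ p _ ks≢ → subst (Lex₂._≺ _) (sym (proj₂ lazy-data))
      (lazy-precedes F m (second p) (second-length p) ks≢))
    where
    module E = Path₁.PathEL E
    module F = Path₂.PathEL F
    module r = Lift r

    lazy-data : proj₁ (second-path k eq r.path) ≡ snd v ×
                map proj₂ r.sequence ≡ replicate m ⊥₋ ++ map [_]₋ F.sequence
    lazy-data = lazy-unique r.seconds-≡ (proj₁ (proj₂ (second-path k eq r.path))) (path⇒lazy F.path m)

    end-v : ∀ {w l} → fst^ w ≡ [ fst v ]± → l ≡ snd v → carry l w ≡ l → w ≡ [ v ]±
    end-v {[ w ]±} refl refl e = cong [_]± (element-≡ refl e)

    second : ∀ {ws ls} → PathR.Path u [ v ]± ws ls →
             LazyPath k (snd v) (seconds k ws) (map proj₂ ls)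
    second p with second-path k eq p
    ... | _ , q , refl = q

    second-length : ∀ {ws ls} → PathR.Path u [ v ]± ws ls →
                    length (seconds k ws) + rQ k ≡ m + rQ (snd v)
    second-length {ws} p = trans (cong (_+ rQ k) (trans (length-seconds k ws)
      (trans (sym (List.length-map fst^ ws))
        (ℕ.+-cancelʳ-≡ (rank^ (fst^ u)) _ _
          (trans (first-length (first-path p)) (sym (first-length E.path))))))) len

    weak : ∀ {ws ls} → PathR.Path u [ v ]± ws ls → map proj₂ r.sequence Lex₂.⊴ map proj₂ ls
    weak {ws} p with List.≡-dec Q._≟_ (seconds k ws) (replicate m k ++ F.vertices)
    ... | yes e = subst (map proj₂ r.sequence Lex₂.⊴_)
      (trans (proj₂ lazy-data) (sym (proj₂ (lazy-unique e (second p) (path⇒lazy F.path m)))))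
      Lex₂.⊴-refl
    ... | no ks≢ = subst (Lex₂._⊴ _) (sym (proj₂ lazy-data))
      (Lex₂.≺⇒⊴ (lazy-precedes F m (second p) (second-length p) ks≢))

  -- The intervals of the hat of the product, by kind of endpoint.

  module _ (el₁ : IsEL (hat P) L₁ λ₁) (el₂ : IsSemiEL Q L₂ λ₂ 0̂) where

    first-EL : ∀ {u v} → u R̂.< v → Path₁.PathEL (fst^ u) (fst^ v)
    first-EL u<v = Path₁.elInterval⇒pathEL (proj₁ (fst^-< u<v)) (el₁ _ _ (fst^-< u<v))

    second-EL : ∀ {k l} → k Q.≤ l → Path₂.PathEL k l
    second-EL {k} {l} k≤l with k Q.≟ l
    ... | yes refl = Path₂.pathEL-refl
    ... | no k≢l with maximalAbove Q l
    ...   | m , l≤m , max = Path₂.elInterval⇒pathEL k≤l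
      (el₂ m max k l (0̂-min k , Q.≤-trans k≤l l≤m) (0̂-min l , l≤m) (k≤l , k≢l))

    lift-length : ∀ {as : List (P.Carrier ±)} {k l m} → (F : Path₂.PathEL k l) →
                  length as + rQ k ≡ m + rQ l → length as ≡ m + length (Path₂.PathEL.vertices F)
    lift-length {as} {k} {l} {m} F eq = ℕ.+-cancelʳ-≡ (rQ k) _ _
      (trans eq (trans (cong (m +_) (sym (path-length (Path₂.PathEL.path F))))
        (sym (ℕ.+-assoc m _ (rQ k)))))

    pathEL-bottom-element : ∀ v → ⊥± R̂.< [ v ]± → PathR.PathEL ⊥± [ v ]±
    pathEL-bottom-element v u<v = pathEL-element ⊥± v (suc m) E F refl eq
      (bottom-lift m E.path (Path₂.PathEL.path F) (lift-length {E.vertices} {m = suc m} F eq))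
      where
      E = first-EL u<v
      module E = Path₁.PathEL E
      F = second-EL (0̂-min (snd v))

      m : ℕ
      -- A chain from `⊥±` has `suc (rP (fst v))` steps, of which `rQ (snd v)` are moves; the other
      -- `suc m` are rests. The subtraction is exact by `rank≥ v`.
      m = rP (fst v) ∸ rQ (snd v)

      eq : length E.vertices + rQ 0̂ ≡ suc m + rQ (snd v)
      eq = trans (cong (length E.vertices +_) rQ-0̂)
        (trans (first-length E.path) (cong suc (sym (ℕ.m∸n+n≡m (rank≥ v)))))

    pathEL-element-element : ∀ u v → [ u ]± R̂.< [ v ]± → PathR.PathEL [ u ]± [ v ]±
    pathEL-element-element u v u<v = pathEL-element [ u ]± v m E F refl eq
      (element-lift m u E.path (Path₂.PathEL.path F) (lift-length {E.vertices} {m = m} F eq))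
      where
      E = first-EL u<v
      module E = Path₁.PathEL E

      u≤v : Rees._≤_ P Q sP sQ u v
      u≤v = proj₁ (HR.[<]-injective u<v)

      F = second-EL (proj₁ (proj₂ u≤v))

      n m : ℕ
      n = length E.vertices
      -- The `n` steps minus the rank difference of the second coordinates, which is the number of
      -- moves.
      m = n + rQ (snd u) ∸ rQ (snd v)

      n-rank : n + rP (fst u) ≡ rP (fst v)
      n-rank = ℕ.suc-injective (trans (sym (ℕ.+-suc n _)) (first-length E.path))

      -- The rank inequality in the Rees order says that `n` steps are enough for all moves, so the
      -- subtraction is exact.
      bound : rQ (snd v) ≤ℕ n + rQ (snd u)
      bound = ℕ.+-cancelʳ-≤ (rP (fst u)) _ _
        (subst (rQ (snd v) + rP (fst u) ≤ℕ_) rearrange (proj₂ (proj₂ u≤v)))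
        where
        rearrange : rP (fst v) + rQ (snd u) ≡ n + rQ (snd u) + rP (fst u)
        rearrange = trans (cong (_+ rQ (snd u)) (sym n-rank))
          (xy∙z≈xz∙y ℕ.+-commutativeSemigroup n _ _)

      eq : n + rQ (snd u) ≡ m + rQ (snd v)
      eq = sym (ℕ.m∸n+n≡m bound)

    reesLabeling-isEL : IsEL (hat reesProduct) (×-poset L₁ (withMinimum L₂)) label
    reesLabeling-isEL u v u<v = PathR.pathEL⇒elInterval (go u v u<v)
      where
      go : ∀ u v → u R̂.< v → PathR.PathEL u v
      go _      ⊥±     u<v = contradiction u<v HR.≮⊥
      go ⊤±     _      u<v = contradiction u<v HR.⊤≮
      go ⊥±     [ v ]± u<v = pathEL-bottom-element v u<v
      go [ u ]± [ v ]± u<v = pathEL-element-element u v u<v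
      go ⊥±     ⊤±     u<v = pathEL-top {0̂} ⊥± refl (first-EL u<v)
      go [ u ]± ⊤±     u<v = pathEL-top [ u ]± refl (first-EL u<v)

theorem2p3 :
  ∀ {a₁ ℓ₁ a₂ ℓ₂ c₁ e₁ o₁ c₂ e₂ o₂ : Level}
    (P₁ : FinPoset a₁ ℓ₁) (P₂ : FinPoset a₂ ℓ₂)
    (s₁ : Semipure P₁) (s₂ : Semipure P₂) →
    SameLength P₁ P₂ →
    (0̂₂ : FinPoset.Carrier P₂) (0̂₂-min : Minimum (FinPoset._≤_ P₂) 0̂₂)
    (L₁ : Poset c₁ e₁ o₁) (L₂ : Poset c₂ e₂ o₂)
    (λ₁ : EdgeLabeling (hat P₁) L₁) (λ₂ : EdgeLabeling P₂ L₂) →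
    IsEL (hat P₁) L₁ λ₁ →
    IsSemiEL P₂ L₂ λ₂ 0̂₂ →
    IsEL (hat (Rees.reesProduct P₁ P₂ s₁ s₂)) (×-poset L₁ (withMinimum L₂))
         (reesLabeling P₁ P₂ s₁ s₂ 0̂₂ 0̂₂-min L₁ L₂ λ₁ λ₂)
theorem2p3 P₁ P₂ s₁ s₂ _ 0̂₂ 0̂₂-min L₁ L₂ λ₁ λ₂ el₁ el₂ =
  ReesPaths.reesLabeling-isEL P₁ P₂ s₁ s₂ 0̂₂ 0̂₂-min L₁ L₂ λ₁ λ₂ el₁ el₂
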